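{- Let $m$ be a positive integer, $I=\{m\}$, and $\rho_m=\frac{m}{e}\,(me)^{1/m}$. Then every complex root of $d(I;z)$ lies in the union of the discs $\mathcal D_k=\{z\in\mathbb C\mid |z-k|\le\rho_m\}$ for $k=0,1,\dots,m-1$.
   Context: $d(I;z)$ is the descent polynomial: the unique polynomial whose value at each integer $n>\max(I\cup\{0\})$ is the number of permutations $\pi\in\mathfrak S_n$ with $\{j\mid\pi_j>\pi_{j+1}\}=I$, evaluated at complex $z$. For $I=\{m\}$, $d(I;z)=\binom{z}{m}-1$. -}

module Defs where

open import Data.Fin using (Fin; toℕ)
import Data.Fin as Fin
open import Data.Fin.Permutation using (Permutation′; _⟨$⟩ʳ_)
import Data.Fin.Permutation as Perm
open import Data.Integer as ℤ using (+_; +[1+_])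
import Data.Integer.Properties as ℤ
open import Data.List using (List; foldr)
open import Data.List.Extrema.Nat using (max)
open import Data.List.Membership.Propositional using (_∈_)
open import Data.Nat as ℕ using (ℕ; zero; suc)
import Data.Nat.Properties as ℕ
open import Data.Product using (Σ; ∃; ∃₂; _×_; _,_; proj₁)
open import Data.Rational
  using (ℚ; mkℚ; 0ℚ; 1ℚ; ½; _+_; _*_; _-_; -_; _/_; 1/_; ∣_∣; _≤_; _<_; *<*
        ; ↥_; toℚᵘ; positive; nonNegative; ≢-nonZero)
open import Data.Rational.Properties
open import Data.Rational.Solver using (module +-*-Solver)
import Data.Rational.Unnormalised as ℚᵘ
import Data.Rational.Unnormalised.Properties as ℚᵘ
open import Data.Sum using (_⊎_; inj₁; inj₂; map₁)
open import Function using (_⇔_)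
open import Function.Bundles using (Inverse)
open import Level using (0ℓ)
open import Relation.Binary.Bundles using (Setoid)
open import Relation.Binary.PropositionalEquality as ≡
  using (_≡_; refl; sym; trans; cong; subst; subst₂)
open import Relation.Nullary using (yes; no; ¬_; contradiction)
open import Relation.Unary using (Decidable)

open import Algebra.Definitions.RawSemiring Data.Rational.+-*-rawSemiring
  using () renaming (_^_ to _^ℚ_) public

open +-*-Solver using (solve; _:+_; _:*_; _:-_; :-_; _:=_)

-- Agrees with 1/_ away from zero; the value at zero is irrelevant.
inv : ℚ → ℚ
inv q with q ≟ 0ℚ
... | yes _  = 0ℚ
... | no q≢0 = (1/ q) {{≢-nonZero q≢0}}

*-inv : ∀ {q} → 0ℚ < q → q * inv q ≡ 1ℚ
*-inv {q} 0<q with q ≟ 0ℚ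
... | yes refl = contradiction 0<q (<-irrefl refl)
... | no q≢0   = *-inverseʳ q {{≢-nonZero q≢0}}

inv-pos : ∀ {q} → 0ℚ < q → 0ℚ < inv q
inv-pos {q} 0<q with q ≟ 0ℚ
... | yes refl = contradiction 0<q (<-irrefl refl)
... | no q≢0   = positive⁻¹ ((1/ q) {{≢-nonZero q≢0}})
                   {{1/pos⇒pos q {{positive 0<q}}}}

0<1 : 0ℚ < 1ℚ
0<1 = positive⁻¹ 1ℚ

+-pos : ∀ {p q} → 0ℚ < p → 0ℚ < q → 0ℚ < p + q
+-pos {p} {q} 0<p 0<q =
  positive⁻¹ (p + q) {{pos+pos⇒pos p {{positive 0<p}} q {{positive 0<q}}}}

*-pos : ∀ {p q} → 0ℚ < p → 0ℚ < q → 0ℚ < p * q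
*-pos {p} {q} 0<p 0<q =
  positive⁻¹ (p * q) {{pos*pos⇒pos p {{positive 0<p}} q {{positive 0<q}}}}

*-nonNeg : ∀ {p q} → 0ℚ ≤ p → 0ℚ ≤ q → 0ℚ ≤ p * q
*-nonNeg {p} {q} 0≤p 0≤q =
  nonNegative⁻¹ (p * q)
    {{nonNeg*nonNeg⇒nonNeg p {{nonNegative 0≤p}} q {{nonNegative 0≤q}}}}

*-mono : ∀ {p q r s} → 0ℚ ≤ p → 0ℚ ≤ s → p ≤ q → r ≤ s → p * r ≤ q * s
*-mono {p} {q} {r} {s} 0≤p 0≤s p≤q r≤s = ≤-trans
  (*-monoˡ-≤-nonNeg p {{nonNegative 0≤p}} r≤s)
  (*-monoʳ-≤-nonNeg s {{nonNegative 0≤s}} p≤q)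

half : ∀ {ε} → 0ℚ < ε → 0ℚ < ε * ½
half 0<ε = *-pos 0<ε (positive⁻¹ ½)

half+half : ∀ ε → ε * ½ + ε * ½ ≡ ε
half+half ε = trans (sym (*-distribˡ-+ ε ½ ½)) (*-identityʳ ε)

-- A bound x - y ≤ ε is written x ≤ y + ε throughout.
∣-∣≤⇒ : ∀ {x y ε} → ∣ x - y ∣ ≤ ε → x ≤ y + ε
∣-∣≤⇒ {x} {y} {ε} h = subst (_≤ y + ε)
  (solve 2 (λ x y → y :+ (x :- y) := x) refl x y)
  (+-monoʳ-≤ y (≤-trans (p≤∣p∣ (x - y)) h))
  where
  p≤∣p∣ : ∀ p → p ≤ ∣ p ∣
  p≤∣p∣ p with ∣p∣≡p∨∣p∣≡-p p
  ... | inj₁ e = ≤-reflexive (sym e)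
  ... | inj₂ e with ≤-total 0ℚ p
  ...   | inj₁ 0≤p = ≤-reflexive (sym (0≤p⇒∣p∣≡p 0≤p))
  ...   | inj₂ p≤0 = ≤-trans p≤0 (0≤∣p∣ p)

⇒∣-∣≤ : ∀ {x y ε} → x ≤ y + ε → y ≤ x + ε → ∣ x - y ∣ ≤ ε
⇒∣-∣≤ {x} {y} {ε} x≤ y≤ with ∣p∣≡p∨∣p∣≡-p (x - y)
... | inj₁ e = subst₂ _≤_
  (trans (solve 2 (λ x y → :- y :+ x := x :- y) refl x y) (sym e))
  (solve 2 (λ y ε → :- y :+ (y :+ ε) := ε) refl y ε)
  (+-monoʳ-≤ (- y) x≤)
... | inj₂ e = subst₂ _≤_
  (trans (solve 2 (λ x y → :- x :+ y := :- (x :- y)) refl x y) (sym e))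
  (solve 2 (λ x ε → :- x :+ (x :+ ε) := ε) refl x ε)
  (+-monoʳ-≤ (- x) y≤)

unit : ℕ → ℚ
unit n = + 1 / suc n

toℚᵘ-/ : ∀ a n → toℚᵘ (+ a / suc n) ℚᵘ.≃ ℚᵘ.mkℚᵘ (+ a) n
toℚᵘ-/ a n = toℚᵘ-fromℚᵘ (ℚᵘ.mkℚᵘ (+ a) n)

unit-antitone : ∀ {m n} → m ℕ.≤ n → unit n ≤ unit m
unit-antitone {m} {n} m≤n = toℚᵘ-cancel-≤
  (ℚᵘ.≤-respˡ-≃ (ℚᵘ.≃-sym (toℚᵘ-/ 1 n)) (ℚᵘ.≤-respʳ-≃ (ℚᵘ.≃-sym (toℚᵘ-/ 1 m))
    (ℚᵘ.*≤* (ℤ.*-monoˡ-≤-nonNeg (+ 1) (ℤ.+≤+ (ℕ.s≤s m≤n))))))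

unit-pos : ∀ n → 0ℚ < unit n
unit-pos n = positive⁻¹ (unit n) {{normalize-pos 1 (suc n)}}

archimedean : ∀ {ε} → 0ℚ < ε → ∃ λ N → unit N ≤ ε
archimedean {ε@(mkℚ +[1+ a ] d _)} _ = d , toℚᵘ-cancel-≤
  (ℚᵘ.≤-respˡ-≃ (ℚᵘ.≃-sym (toℚᵘ-/ 1 d))
    (ℚᵘ.*≤* (ℤ.*-monoʳ-≤-nonNeg (+ suc d) {+ 1} {+ suc a} (ℤ.+≤+ (ℕ.s≤s ℕ.z≤n)))))
archimedean {mkℚ (+ 0) d _}     (*<* (ℤ.+<+ ()))
archimedean {mkℚ ℤ.-[1+ a ] d _} (*<* ())

-- Real numbers are Cauchy sequences of rationals, taken up to _≈ℝ_.
record ℝ : Set where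
  field
    seq    : ℕ → ℚ
    cauchy : ∀ ε → 0ℚ < ε →
             ∃ λ N → ∀ m n → N ℕ.≤ m → N ℕ.≤ n → ∣ seq m - seq n ∣ ≤ ε

open ℝ public

infix 4 _≈ℝ_ _≤ℝ_ _<ℝ_

_≈ℝ_ : ℝ → ℝ → Set
x ≈ℝ y = ∀ ε → 0ℚ < ε → ∃ λ N → ∀ n → N ℕ.≤ n → ∣ seq x n - seq y n ∣ ≤ ε

_≤ℝ_ : ℝ → ℝ → Set
x ≤ℝ y = ∀ ε → 0ℚ < ε → ∃ λ N → ∀ n → N ℕ.≤ n → seq x n ≤ seq y n + ε

_<ℝ_ : ℝ → ℝ → Set
x <ℝ y = ∃ λ δ → 0ℚ < δ × ∃ λ N → ∀ n → N ℕ.≤ n → seq x n + δ ≤ seq y n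

-- The Cauchy condition may be checked one side at a time.
mkCauchy : (s : ℕ → ℚ) →
           (∀ ε → 0ℚ < ε →
             ∃ λ N → ∀ m n → N ℕ.≤ m → N ℕ.≤ n → s m ≤ s n + ε) →
           ℝ
mkCauchy s c = record
  { seq    = s
  ; cauchy = λ ε 0<ε → let N , h = c ε 0<ε in
      N , λ m n N≤m N≤n → ⇒∣-∣≤ (h m n N≤m N≤n) (h n m N≤n N≤m)
  }

cauchy≤ : (x : ℝ) → ∀ ε → 0ℚ < ε →
          ∃ λ N → ∀ m n → N ℕ.≤ m → N ℕ.≤ n → seq x m ≤ seq x n + ε
cauchy≤ x ε 0<ε = let N , h = cauchy x ε 0<ε in
  N , λ m n N≤m N≤n → ∣-∣≤⇒ (h m n N≤m N≤n)

fromℚ : ℚ → ℝ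
fromℚ q = mkCauchy (λ _ → q) λ ε 0<ε →
  0 , λ _ _ _ _ → subst (_≤ q + ε) (+-identityʳ q) (+-monoʳ-≤ q (<⇒≤ 0<ε))

fromℕ : ℕ → ℝ
fromℕ n = fromℚ (+ n / 1)

0ℝ 1ℝ : ℝ
0ℝ = fromℚ 0ℚ
1ℝ = fromℚ 1ℚ

infixl 6 _+ℝ_ _-ℝ_
infixl 7 _*ℝ_
infix  8 -ℝ_

_+ℝ_ : ℝ → ℝ → ℝ
x +ℝ y = mkCauchy (λ n → seq x n + seq y n) λ ε 0<ε →
  let M , f = cauchy≤ x (ε * ½) (half 0<ε)
      N , g = cauchy≤ y (ε * ½) (half 0<ε)
  in M ℕ.+ N , λ m n ≤m ≤n → subst (seq x m + seq y m ≤_)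
       (trans
         (solve 3 (λ a b h → (a :+ h) :+ (b :+ h) := (a :+ b) :+ (h :+ h)) refl
           (seq x n) (seq y n) (ε * ½))
         (cong (_+_ (seq x n + seq y n)) (half+half ε)))
       (+-mono-≤
         (f m n (ℕ.m+n≤o⇒m≤o M ≤m) (ℕ.m+n≤o⇒m≤o M ≤n))
         (g m n (ℕ.m+n≤o⇒n≤o M ≤m) (ℕ.m+n≤o⇒n≤o M ≤n)))

-ℝ_ : ℝ → ℝ
-ℝ x = mkCauchy (λ n → - seq x n) λ ε 0<ε →
  let N , f = cauchy≤ x ε 0<ε
  in N , λ m n ≤m ≤n → subst₂ _≤_
       (solve 2 (λ a b → :- a :+ (b :- b) := :- a) refl (seq x m) (seq x n))
       (solve 3 (λ a b h → :- a :+ ((a :+ h) :- b) := :- b :+ h) refl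
         (seq x m) (seq x n) ε)
       (+-monoʳ-≤ (- seq x m) (+-monoˡ-≤ (- seq x n) (f n m ≤n ≤m)))

_-ℝ_ : ℝ → ℝ → ℝ
x -ℝ y = x +ℝ (-ℝ y)

bounded : (x : ℝ) → ∃₂ λ B N → 0ℚ < B × (∀ n → N ℕ.≤ n → ∣ seq x n ∣ ≤ B)
bounded x =
  let N , f = cauchy x 1ℚ 0<1
      c     = seq x N
  in ∣ c ∣ + 1ℚ , N , +-pos-nonNeg (0≤∣p∣ c) ,
     λ n N≤n → subst (_≤ ∣ c ∣ + 1ℚ)
       (cong ∣_∣ (solve 2 (λ c a → c :+ (a :- c) := a) refl c (seq x n)))
       (≤-trans (∣p+q∣≤∣p∣+∣q∣ c (seq x n - c))
                (+-monoʳ-≤ ∣ c ∣ (f n N N≤n ℕ.≤-refl)))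
  where
  +-pos-nonNeg : ∀ {p} → 0ℚ ≤ p → 0ℚ < p + 1ℚ
  +-pos-nonNeg {p} 0≤p = <-≤-trans 0<1
    (subst (_≤ p + 1ℚ) (+-identityˡ 1ℚ) (+-monoˡ-≤ 1ℚ 0≤p))

_*ℝ_ : ℝ → ℝ → ℝ
x *ℝ y = record
  { seq    = λ n → seq x n * seq y n
  ; cauchy = λ ε 0<ε →
      let B , M , 0<B , f = bounded x
          C , N , 0<C , g = bounded y
          K   = B + C
          0<K = +-pos 0<B 0<C
          δ   = ε * ½ * inv K
          0<δ = *-pos (half 0<ε) (inv-pos 0<K)
          P , p = cauchy x δ 0<δ
          Q , q = cauchy y δ 0<δ
          B≤K = subst (_≤ K) (+-identityʳ B) (+-monoʳ-≤ B (<⇒≤ 0<C))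
          C≤K = subst (_≤ K) (+-identityˡ C) (+-monoˡ-≤ C (<⇒≤ 0<B))
          Kδ : K * δ ≡ ε * ½
          Kδ = trans
            (solve 3 (λ k h i → k :* (h :* i) := (k :* i) :* h) refl
              K (ε * ½) (inv K))
            (trans (cong (_* (ε * ½)) (*-inv 0<K)) (*-identityˡ (ε * ½)))
      in (M ℕ.+ N) ℕ.+ (P ℕ.+ Q) , λ m n ≤m ≤n →
        let a = seq x m ; b = seq y m ; c = seq x n ; d = seq y n
            M≤m = ℕ.m+n≤o⇒m≤o M (ℕ.m+n≤o⇒m≤o (M ℕ.+ N) ≤m)
            N≤n = ℕ.m+n≤o⇒n≤o M (ℕ.m+n≤o⇒m≤o (M ℕ.+ N) ≤n)
            P≤m = ℕ.m+n≤o⇒m≤o P (ℕ.m+n≤o⇒n≤o (M ℕ.+ N) ≤m)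
            P≤n = ℕ.m+n≤o⇒m≤o P (ℕ.m+n≤o⇒n≤o (M ℕ.+ N) ≤n)
            Q≤m = ℕ.m+n≤o⇒n≤o P (ℕ.m+n≤o⇒n≤o (M ℕ.+ N) ≤m)
            Q≤n = ℕ.m+n≤o⇒n≤o P (ℕ.m+n≤o⇒n≤o (M ℕ.+ N) ≤n)
            left : ∣ a * (b - d) ∣ ≤ ε * ½
            left = subst₂ _≤_ (sym (∣p*q∣≡∣p∣*∣q∣ a (b - d))) Kδ
              (*-mono (0≤∣p∣ a) (<⇒≤ 0<δ)
                (≤-trans (f m M≤m) B≤K) (q m n Q≤m Q≤n))
            right : ∣ d * (a - c) ∣ ≤ ε * ½
            right = subst₂ _≤_ (sym (∣p*q∣≡∣p∣*∣q∣ d (a - c))) Kδ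
              (*-mono (0≤∣p∣ d) (<⇒≤ 0<δ)
                (≤-trans (g n N≤n) C≤K) (p m n P≤m P≤n))
        in subst₂ _≤_
             (cong ∣_∣ (solve 4 (λ a b c d →
               a :* (b :- d) :+ d :* (a :- c) := a :* b :- c :* d) refl a b c d))
             (half+half ε)
             (≤-trans (∣p+q∣≤∣p∣+∣q∣ (a * (b - d)) (d * (a - c)))
                      (+-mono-≤ left right))
  }

recip : (x : ℝ) → 0ℝ <ℝ x → ℝ
recip x (δ , 0<δ , M , δ≤) = mkCauchy (λ n → inv (seq x n)) λ ε 0<ε →
  let N , f = cauchy≤ x (ε * (δ * δ)) (*-pos 0<ε (*-pos 0<δ 0<δ))
  in M ℕ.+ N , λ m n ≤m ≤n →
     lem (<⇒≤ 0<ε) (big m (ℕ.m+n≤o⇒m≤o M ≤m)) (big n (ℕ.m+n≤o⇒m≤o M ≤n))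
         (f n m (ℕ.m+n≤o⇒n≤o M ≤n) (ℕ.m+n≤o⇒n≤o M ≤m))
  where
  big : ∀ n → M ℕ.≤ n → δ ≤ seq x n
  big n M≤n = subst (_≤ seq x n) (+-identityˡ δ) (δ≤ n M≤n)

  lem : ∀ {a b ε} → 0ℚ ≤ ε → δ ≤ a → δ ≤ b → b ≤ a + ε * (δ * δ) →
        inv a ≤ inv b + ε
  lem {a} {b} {ε} 0≤ε δ≤a δ≤b b≤ = begin
    i                                   ≡⟨ sym (*-identityʳ i) ⟩
    i * 1ℚ                              ≡⟨ cong (i *_) (sym (*-inv 0<b)) ⟩
    i * (b * j)                         ≡⟨ solve 3 (λ i b j →
                                             i :* (b :* j) := (i :* j) :* b)
                                             refl i b j ⟩
    (i * j) * b                         ≤⟨ *-monoˡ-≤-nonNeg (i * j)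
                                             {{nonNegative (*-nonNeg 0≤i 0≤j)}} b≤ ⟩
    (i * j) * (a + ε * (δ * δ))         ≡⟨ solve 5 (λ i j a e d →
                                             (i :* j) :* (a :+ e :* (d :* d)) :=
                                             (a :* i) :* j :+
                                               e :* ((d :* i) :* (d :* j)))
                                             refl i j a ε δ ⟩
    (a * i) * j + ε * ((δ * i) * (δ * j)) ≡⟨ cong (λ t → t * j +
                                               ε * ((δ * i) * (δ * j))) (*-inv 0<a) ⟩
    1ℚ * j + ε * ((δ * i) * (δ * j))    ≡⟨ cong (_+ ε * ((δ * i) * (δ * j)))
                                             (*-identityˡ j) ⟩
    j + ε * ((δ * i) * (δ * j))         ≤⟨ +-monoʳ-≤ j (*-monoˡ-≤-nonNeg ε
                                             {{nonNegative 0≤ε}}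
                                             (*-mono (*-nonNeg (<⇒≤ 0<δ) 0≤i)
                                               (<⇒≤ 0<1) (δi≤1 δ≤a) (δi≤1 δ≤b))) ⟩
    j + ε * (1ℚ * 1ℚ)                   ≡⟨ cong (_+_ j) (*-identityʳ ε) ⟩
    j + ε                               ∎
    where
    open ≤-Reasoning
    i = inv a
    j = inv b
    0<a = <-≤-trans 0<δ δ≤a
    0<b = <-≤-trans 0<δ δ≤b
    0≤i = <⇒≤ (inv-pos 0<a)
    0≤j = <⇒≤ (inv-pos 0<b)
    δi≤1 : ∀ {c} → δ ≤ c → δ * inv c ≤ 1ℚ
    δi≤1 {c} δ≤c = subst (δ * inv c ≤_) (*-inv 0<c)
      (*-monoʳ-≤-nonNeg (inv c) {{nonNegative (<⇒≤ (inv-pos 0<c))}} δ≤c)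
      where 0<c = <-≤-trans 0<δ δ≤c

invFactorial : ℕ → ℚ
invFactorial zero    = 1ℚ
invFactorial (suc k) = invFactorial k * unit k

expSum : ℕ → ℚ
expSum zero    = invFactorial 0
expSum (suc n) = expSum n + invFactorial (suc n)

invFactorial-pos : ∀ k → 0ℚ < invFactorial k
invFactorial-pos zero    = 0<1
invFactorial-pos (suc k) = *-pos (invFactorial-pos k) (unit-pos k)

unit≤1 : ∀ k → unit k ≤ 1ℚ
unit≤1 k = unit-antitone {0} {k} ℕ.z≤n

invFactorial≤1 : ∀ k → invFactorial k ≤ 1ℚ
invFactorial≤1 zero    = ≤-refl
invFactorial≤1 (suc k) =
  *-mono (<⇒≤ (invFactorial-pos k)) (<⇒≤ 0<1) (invFactorial≤1 k) (unit≤1 k)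

invFactorial≤unit : ∀ k → invFactorial (suc k) ≤ unit k
invFactorial≤unit k = subst (invFactorial (suc k) ≤_) (*-identityˡ (unit k))
  (*-monoʳ-≤-nonNeg (unit k) {{nonNegative (<⇒≤ (unit-pos k))}} (invFactorial≤1 k))

≤-step : ∀ {p q} → 0ℚ ≤ q → p ≤ p + q
≤-step {p} {q} 0≤q = subst (_≤ p + q) (+-identityʳ p) (+-monoʳ-≤ p 0≤q)

expSum-mono : ∀ {m n} → m ℕ.≤′ n → expSum m ≤ expSum n
expSum-mono (ℕ.≤′-reflexive refl) = ≤-refl
expSum-mono (ℕ.≤′-step {n} m≤n)   =
  ≤-trans (expSum-mono m≤n) (≤-step (<⇒≤ (invFactorial-pos (suc n))))

-- Adding the last term a second time bounds all later partial sums.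
expSum-bound : ∀ {m n} → suc m ℕ.≤′ n →
               expSum n + invFactorial n ≤ expSum (suc m) + invFactorial (suc m)
expSum-bound (ℕ.≤′-reflexive refl)      = ≤-refl
expSum-bound {m} (ℕ.≤′-step {zero} (ℕ.≤′-reflexive ()))
expSum-bound {m} (ℕ.≤′-step {suc n} m≤n) = ≤-trans
  (subst (_≤ expSum (suc n) + invFactorial (suc n))
    (sym (+-assoc (expSum (suc n)) t t))
    (+-monoʳ-≤ (expSum (suc n)) tt≤))
  (expSum-bound m≤n)
  where
  c = invFactorial (suc n)
  t = invFactorial (suc (suc n))
  t≤ : t ≤ c * ½
  t≤ = *-monoˡ-≤-nonNeg c {{nonNegative (<⇒≤ (invFactorial-pos (suc n)))}}
         (unit-antitone {1} {suc n} (ℕ.s≤s ℕ.z≤n))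
  tt≤ : t + t ≤ c
  tt≤ = subst (t + t ≤_) (half+half c) (+-mono-≤ t≤ t≤)

-- e = ∑ 1/k!
e : ℝ
e = mkCauchy expSum λ ε 0<ε →
  let N , h = archimedean 0<ε
  in suc N , λ m n ≤m ≤n → begin
       expSum m                                  ≤⟨ ≤-step (<⇒≤ (invFactorial-pos m)) ⟩
       expSum m + invFactorial m                 ≤⟨ expSum-bound (ℕ.≤⇒≤′ ≤m) ⟩
       expSum (suc N) + invFactorial (suc N)     ≤⟨ +-mono-≤ (expSum-mono (ℕ.≤⇒≤′ ≤n))
                                                     (≤-trans (invFactorial≤unit N) h) ⟩
       expSum n + ε                              ∎
  where open ≤-Reasoning

0<e : 0ℝ <ℝ e
0<e = 1ℚ , 0<1 , 0 , λ n 0≤n →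
  subst (_≤ expSum n) (sym (+-identityˡ 1ℚ)) (expSum-mono (ℕ.≤⇒≤′ 0≤n))

greatest : {P : ℕ → Set} → Decidable P → ℕ → ℕ
greatest P? zero    = zero
greatest P? (suc b) with P? (suc b)
... | yes _ = suc b
... | no _  = greatest P? b

greatest-holds : {P : ℕ → Set} (P? : Decidable P) → ∀ b →
                 greatest P? b ≡ 0 ⊎ P (greatest P? b)
greatest-holds P? zero = inj₁ refl
greatest-holds P? (suc b) with P? (suc b)
... | yes p = inj₂ p
... | no _  = greatest-holds P? b

greatest-max : {P : ℕ → Set} (P? : Decidable P) → ∀ b →
               ¬ P (suc b) → ¬ P (suc (greatest P? b))
greatest-max P? zero    ¬p = ¬p
greatest-max P? (suc b) ¬p with P? (suc b)
... | yes _  = ¬p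
... | no ¬p′ = greatest-max P? b ¬p′

grid : ℕ → ℕ → ℚ
grid n j = + j / suc n

-- No grid point beyond  gridBound n q  has its m-th power (m ≥ 1) below q.
gridBound : ℕ → ℚ → ℕ
gridBound n q = suc n ℕ.* suc ℤ.∣ ↥ q ∣

approxIndex : ℕ → ℕ → ℚ → ℕ
approxIndex m n q = greatest (λ j → (grid n j ^ℚ m) ≤? q) (gridBound n q)

-- The largest multiple r of 1/(n+1) with r ≥ 0 and r ^ m ≤ q, or 0 if q < 0.
approxRoot : ℕ → ℕ → ℚ → ℚ
approxRoot m n q = grid n (approxIndex m n q)

grid-nonNeg : ∀ n j → 0ℚ ≤ grid n j
grid-nonNeg n j = nonNegative⁻¹ (grid n j) {{normalize-nonNeg j (suc n)}}

approxRoot-nonNeg : ∀ m n q → 0ℚ ≤ approxRoot m n q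
approxRoot-nonNeg m n q = grid-nonNeg n (approxIndex m n q)

grid-suc : ∀ n j → grid n (suc j) ≡ grid n j + unit n
grid-suc n j = toℚᵘ-injective (ℚᵘ.≃-trans (toℚᵘ-/ (suc j) n) (ℚᵘ.≃-sym
  (ℚᵘ.≃-trans (toℚᵘ-homo-+ (grid n j) (unit n))
  (ℚᵘ.≃-trans (ℚᵘ.+-cong (toℚᵘ-/ j n) (toℚᵘ-/ 1 n)) eq))))
  where
  eq : ℚᵘ.mkℚᵘ (+ j) n ℚᵘ.+ ℚᵘ.mkℚᵘ (+ 1) n ℚᵘ.≃ ℚᵘ.mkℚᵘ (+ suc j) n
  eq = ℚᵘ.*≡* (trans
    (cong (ℤ._* + suc n) (trans
      (sym (ℤ.*-distribʳ-+ (+ suc n) (+ j) (+ 1)))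
      (cong (λ k → + k ℤ.* + suc n) (ℕ.+-comm j 1))))
    (ℤ.*-assoc (+ suc j) (+ suc n) (+ suc n)))

^-nonNeg : ∀ {p} m → 0ℚ ≤ p → 0ℚ ≤ p ^ℚ m
^-nonNeg zero    0≤p = <⇒≤ 0<1
^-nonNeg (suc m) 0≤p = *-nonNeg 0≤p (^-nonNeg m 0≤p)

^-pos : ∀ {p} m → 0ℚ < p → 0ℚ < p ^ℚ m
^-pos zero    0<p = 0<1
^-pos (suc m) 0<p = *-pos 0<p (^-pos m 0<p)

^-mono : ∀ {p q} m → 0ℚ ≤ p → p ≤ q → p ^ℚ m ≤ q ^ℚ m
^-mono zero    0≤p p≤q = ≤-refl
^-mono (suc m) 0≤p p≤q =
  *-mono 0≤p (^-nonNeg m (≤-trans 0≤p p≤q)) p≤q (^-mono m 0≤p p≤q)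

^-superadditive : ∀ {p q} m .{{_ : ℕ.NonZero m}} → 0ℚ ≤ p → 0ℚ ≤ q →
                  p ^ℚ m + q ^ℚ m ≤ (p + q) ^ℚ m
^-superadditive {p} {q} (suc m) 0≤p 0≤q = ≤-trans
  (+-mono-≤
    (*-monoˡ-≤-nonNeg p {{nonNegative 0≤p}} (^-mono m 0≤p (≤-step 0≤q)))
    (*-monoˡ-≤-nonNeg q {{nonNegative 0≤q}}
      (^-mono m 0≤q (subst (q ≤_) (+-comm q p) (≤-step 0≤p)))))
  (≤-reflexive (sym (*-distribʳ-+ ((p + q) ^ℚ m) p q)))

^-expand : ∀ {p} m .{{_ : ℕ.NonZero m}} → 1ℚ ≤ p → p ≤ p ^ℚ m
^-expand {p} (suc m) 1≤p = subst (_≤ p * p ^ℚ m) (*-identityʳ p)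
  (*-monoˡ-≤-nonNeg p {{nonNegative (≤-trans (<⇒≤ 0<1) 1≤p)}}
    (subst (_≤ p ^ℚ m) (1^ m) (^-mono m (<⇒≤ 0<1) 1≤p)))
  where
  1^ : ∀ m → 1ℚ ^ℚ m ≡ 1ℚ
  1^ zero    = refl
  1^ (suc m) = trans (*-identityˡ (1ℚ ^ℚ m)) (1^ m)

grid-zero : ∀ n → grid n 0 ≡ 0ℚ
grid-zero n = toℚᵘ-injective (ℚᵘ.≃-trans (toℚᵘ-/ 0 n) (ℚᵘ.*≡* refl))

approxRoot-lower : ∀ m n q →
  approxRoot m n q ≡ 0ℚ ⊎ approxRoot m n q ^ℚ m ≤ q
approxRoot-lower m n q = map₁ (λ z → trans (cong (grid n) z) (grid-zero n))
  (greatest-holds (λ j → (grid n j ^ℚ m) ≤? q) (gridBound n q))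

approxRoot-upper : ∀ m .{{_ : ℕ.NonZero m}} n q →
  q < (approxRoot m n q + unit n) ^ℚ m
approxRoot-upper m n q = subst (λ r → q < r ^ℚ m)
  (grid-suc n (approxIndex m n q))
  (≰⇒> (greatest-max (λ j → (grid n j ^ℚ m) ≤? q) (gridBound n q)
    (λ g^m≤q → <-irrefl refl (<-≤-trans (q<c q)
      (≤-trans (≤-trans (c≤g q) (^-expand m (≤-trans (1≤c q) (c≤g q)))) g^m≤q)))))
  where
  c : ℚ → ℚ
  c q = + suc ℤ.∣ ↥ q ∣ / 1

  q<c : ∀ q → q < c q
  q<c q@(mkℚ (+ a) d _) = toℚᵘ-cancel-<
    (ℚᵘ.<-respʳ-≃ (ℚᵘ.≃-sym (toℚᵘ-/ (suc a) 0)) (ℚᵘ.*<*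
      (subst₂ ℤ._<_ (ℤ.pos-* a 1) (ℤ.pos-* (suc a) (suc d))
        (ℤ.+<+ (subst (ℕ._< suc a ℕ.* suc d) (sym (ℕ.*-identityʳ a))
          (ℕ.m≤m*n (suc a) (suc d)))))))
  q<c q@(mkℚ ℤ.-[1+ a ] d _) = neg<pos q (c q) {{_}} {{normalize-pos (suc (suc a)) 1}}

  1≤c : ∀ q → 1ℚ ≤ c q
  1≤c q = toℚᵘ-cancel-≤ (ℚᵘ.≤-respʳ-≃ (ℚᵘ.≃-sym (toℚᵘ-/ (suc ℤ.∣ ↥ q ∣) 0))
    (ℚᵘ.*≤* (ℤ.*-monoʳ-≤-nonNeg (+ 1) {+ 1} {+ suc ℤ.∣ ↥ q ∣} (ℤ.+≤+ (ℕ.s≤s ℕ.z≤n)))))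

  c≤g : ∀ q → c q ≤ grid n (suc (gridBound n q))
  c≤g q = toℚᵘ-cancel-≤
    (ℚᵘ.≤-respˡ-≃ (ℚᵘ.≃-sym (toℚᵘ-/ s 0))
    (ℚᵘ.≤-respʳ-≃ (ℚᵘ.≃-sym (toℚᵘ-/ (suc (gridBound n q)) n))
    (ℚᵘ.*≤* (subst₂ ℤ._≤_ (ℤ.pos-* s (suc n)) (ℤ.pos-* (suc (gridBound n q)) 1)
      (ℤ.+≤+ (subst₂ ℕ._≤_ (ℕ.*-comm (suc n) s)
                (sym (ℕ.*-identityʳ (suc (gridBound n q))))
                (ℕ.n≤1+n (gridBound n q))))))))
    where s = suc ℤ.∣ ↥ q ∣

root-step : ∀ m .{{_ : ℕ.NonZero m}} {a b r t u η} →
  r ≡ 0ℚ ⊎ r ^ℚ m ≤ a → b < (t + u) ^ℚ m → a ≤ b + η ^ℚ m →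
  0ℚ ≤ t → 0ℚ ≤ u → u ≤ η → 0ℚ < η → r ≤ t + (η + η)
root-step m {t = t} {η = η} (inj₁ refl) _ _ 0≤t _ _ 0<η =
  ≤-trans 0≤t (≤-step (<⇒≤ (+-pos 0<η 0<η)))
root-step m {a} {b} {r} {t} {u} {η} (inj₂ r^m≤a) b< a≤ 0≤t 0≤u u≤η 0<η =
  ≮⇒≥ λ t+2η<r → <-irrefl refl (begin-strict
    b + η ^ℚ m               <⟨ +-monoˡ-< (η ^ℚ m) b< ⟩
    (t + u) ^ℚ m + η ^ℚ m    ≤⟨ ^-superadditive m 0≤s (<⇒≤ 0<η) ⟩
    ((t + u) + η) ^ℚ m       ≤⟨ ^-mono m (≤-trans 0≤s (≤-step (<⇒≤ 0<η))) (s+η≤ t+2η<r) ⟩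
    r ^ℚ m                   ≤⟨ r^m≤a ⟩
    a                        ≤⟨ a≤ ⟩
    b + η ^ℚ m               ∎)
  where
  open ≤-Reasoning
  0≤s : 0ℚ ≤ t + u
  0≤s = ≤-trans 0≤t (≤-step 0≤u)
  s+η≤ : t + (η + η) < r → (t + u) + η ≤ r
  s+η≤ h = begin
    (t + u) + η   ≤⟨ +-monoˡ-≤ η (+-monoʳ-≤ t u≤η) ⟩
    (t + η) + η   ≡⟨ +-assoc t η η ⟩
    t + (η + η)   ≤⟨ <⇒≤ h ⟩
    r             ∎

-- The nonnegative m-th root of max(x, 0).
root : (m : ℕ) .{{_ : ℕ.NonZero m}} → ℝ → ℝ
root m x = mkCauchy (λ n → approxRoot m n (seq x n)) λ ε 0<ε →
  let 0<η   = half 0<ε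
      N , f = cauchy≤ x ((ε * ½) ^ℚ m) (^-pos m 0<η)
      K , h = archimedean 0<η
  in N ℕ.+ K , λ i j ≤i ≤j →
     subst (λ t → approxRoot m i (seq x i) ≤ approxRoot m j (seq x j) + t)
       (half+half ε)
       (root-step m
         (approxRoot-lower m i (seq x i)) (approxRoot-upper m j (seq x j))
         (f i j (ℕ.m+n≤o⇒m≤o N ≤i) (ℕ.m+n≤o⇒m≤o N ≤j))
         (approxRoot-nonNeg m j (seq x j)) (<⇒≤ (unit-pos j))
         (≤-trans (unit-antitone (ℕ.m+n≤o⇒n≤o N ≤j)) h) 0<η)

record ℂ : Set where
  constructor _+i_
  field
    re im : ℝ

open ℂ public

infix  4 _≈ℂ_
infixl 6 _+ℂ_ _-ℂ_
infixl 7 _*ℂ_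

_≈ℂ_ : ℂ → ℂ → Set
w ≈ℂ z = re w ≈ℝ re z × im w ≈ℝ im z

ℕ→ℂ : ℕ → ℂ
ℕ→ℂ n = fromℕ n +i 0ℝ

0ℂ : ℂ
0ℂ = 0ℝ +i 0ℝ

_+ℂ_ _-ℂ_ _*ℂ_ : ℂ → ℂ → ℂ
w +ℂ z = (re w +ℝ re z) +i (im w +ℝ im z)
w -ℂ z = (re w -ℝ re z) +i (im w -ℝ im z)
w *ℂ z = (re w *ℝ re z -ℝ im w *ℝ im z) +i (re w *ℝ im z +ℝ im w *ℝ re z)

∣_∣ℂ : ℂ → ℝ
∣ z ∣ℂ = root 2 (re z *ℝ re z +ℝ im z *ℝ im z)

-- Coefficient lists, constant term first.
Polynomial : Set
Polynomial = List ℂ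

eval : Polynomial → ℂ → ℂ
eval p z = foldr (λ c r → c +ℂ z *ℂ r) 0ℂ p

-- Positions are counted from 1, whereas Fin n counts from 0: the entry π_j
-- is the value at the a with  suc (toℕ a) ≡ j , and π_{j+1} the value at the
-- b with  toℕ b ≡ j .
IsDescent : ∀ {n} → Permutation′ n → ℕ → Set
IsDescent {n} π j = ∃₂ λ (a b : Fin n) →
  suc (toℕ a) ≡ j × toℕ b ≡ j × (π ⟨$⟩ʳ b) Fin.< (π ⟨$⟩ʳ a)

-- Finite sets of naturals are lists, of which only membership matters.
HasDescentSet : ∀ {n} → Permutation′ n → List ℕ → Set
HasDescentSet π I = ∀ j → IsDescent π j ⇔ j ∈ I

-- Permutations are identified when they agree pointwise.
DescentClass : List ℕ → ℕ → Setoid 0ℓ 0ℓ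
DescentClass I n = record
  { Carrier       = Σ (Permutation′ n) λ π → HasDescentSet π I
  ; _≈_           = λ π σ → proj₁ π Perm.≈ proj₁ σ
  ; isEquivalence = record
    { refl  = λ _ → refl
    ; sym   = λ h i → sym (h i)
    ; trans = λ h k i → trans (h i) (k i)
    }
  }

HasCardinality : Setoid 0ℓ 0ℓ → ℕ → Set
HasCardinality S N = Inverse (≡.setoid (Fin N)) S

-- These conditions determine d(I;z) up to ≈ℂ at every z, since infinitely many
-- values determine a polynomial function.
IsDescentPolynomial : List ℕ → Polynomial → Set
IsDescentPolynomial I d = ∀ n → max 0 I ℕ.< n →
  ∃ λ N → HasCardinality (DescentClass I n) N × eval d (ℕ→ℂ n) ≈ℂ ℕ→ℂ N

ρ : (m : ℕ) .{{_ : ℕ.NonZero m}} → ℝ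
ρ m = (fromℕ m *ℝ recip e 0<e) *ℝ root m (fromℕ m *ℝ e)

{-# OPTIONS --safe #-}
module Submission where

-- The values d(n) = C(n,m) - 1 for n > m determine the polynomial function d:
-- m! d(z) = z(z-1)⋯(z-m+1) - m!. At a root the product of the distances
-- |z - k|, 0 ≤ k < m, is therefore m!, so the least of them has its m-th power
-- at most m!. The inequality m! ≤ ρ_m ^ m amounts to m! e^(m-1) ≤ m^(m+1), which
-- follows by induction from e ≤ (1 + 1/m)^(m+1). It is strict for m ≥ 2; only
-- this gap makes it decidable which of the distances is small.

-- Comparison of Cauchy reals is not decidable, so a smallest distance cannot simply be picked. Only
-- rational approximations at one fixed index can be compared, and the disc found that way depends
-- on the tolerance. For m ≥ 2 a single tolerance suffices, because the squared bound exceeds (m!)²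
-- by at least 7/9, uniformly in m and in the index. For m = 1 there is no gap, as ρ_1 = 1 = 1!, but
-- also nothing to choose. Equality in ℂ is not decidable either, so the degree of `d` cannot be
-- read off its coefficients. Polynomial functions therefore carry a mere degree bound, and the only
-- cancellation is by differences of sample points. The estimates are made index by index: e enters
-- as a partial sum, and the approximate root is raised by one grid step so that the factorial
-- inequality holds at each index and not only in the limit. Distances are squared because squared
-- norms multiply exactly, term by term, whereas `∣_∣ℂ` is an approximated root.

open import Defs
open import Data.Nat using (ℕ; NonZero)
open import Data.Fin using (Fin; toℕ)
open import Data.List using ([]; _∷_)
open import Data.Product using (Σ)

open import Algebra.Bundles using (CommutativeRing)
import Algebra.Properties.Group
import Algebra.Properties.Ring
import Algebra.Solver.Ring.NaturalCoefficients.Default as Solver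
open import Data.Bool using (Bool; true; false; not)
open import Data.Bool.Properties using (T-≡)
open import Data.Fin as Fin using (splitAt; join; _↑ˡ_; _↑ʳ_; fromℕ<)
open import Data.Fin.Permutation as Perm
  using (Permutation′; permutation; _⟨$⟩ʳ_; _⟨$⟩ˡ_; inverseʳ; inverseˡ)
import Data.Fin.Properties as Fin
open import Data.Integer as ℤ using (+_)
import Data.Integer.Properties as ℤ
open import Data.List using (length)
open import Data.List.Relation.Unary.Any using (here)
open import Data.Nat as ℕ using (zero; suc; _!)
import Data.Nat.Properties as ℕ
import Data.Nat.Solver
open import Data.Product using (∃; _×_; _,_; proj₁; proj₂)
open import Data.Sum as Sum using (_⊎_; inj₁; inj₂; [_,_]′)
open import Function using (_∘_; id; mk⇔; Inverse; Equivalence; Injective)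
open import Level using (0ℓ)
open import Relation.Binary.Definitions using (tri<; tri≈; tri>)
open import Relation.Binary.PropositionalEquality as ≡ using (_≡_; _≢_; _≗_)
open import Relation.Nullary using (Dec; yes; no; ¬_; contradiction; _×-dec_)

open Data.Nat.Solver.+-*-Solver using ()
  renaming (solve to solveℕ; _:+_ to _⊕_; _:*_ to _⊗_; _:=_ to _⊜_; con to κ)

-- Polynomial functions over a commutative ring

module DividedDifference {a ℓ} (R : CommutativeRing a ℓ) where
  open CommutativeRing R
  open Solver commutativeSemiring using (solve; _:+_; _:*_; _:=_; con)
  open import Relation.Binary.Reasoning.Setoid setoid

  -- Polynomial functions of degree less than n; u stands for the difference
  -- z - w, so that g is the divided difference of f at w.
  Poly : ℕ → (Carrier → Carrier) → Set (a Level.⊔ ℓ)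
  Poly zero    f = Level.Lift a (∀ z → f z ≈ 0#)
  Poly (suc n) f = ∀ w → ∃ λ g → Poly n g ×
    (∀ z u → z ≈ w + u → f z ≈ f w + u * g z)

  Poly-cong : ∀ n {f g} → (∀ z → f z ≈ g z) → Poly n f → Poly n g
  Poly-cong zero    f≗g (Level.lift f≈0) =
    Level.lift λ z → trans (sym (f≗g z)) (f≈0 z)
  Poly-cong (suc n) f≗g F w = let h , H , eq = F w in
    h , H , λ z u z≈ →
      trans (sym (f≗g z)) (trans (eq z u z≈) (+-congʳ (f≗g w)))

  Poly-+ : ∀ n {f g} → Poly n f → Poly n g → Poly n (λ z → f z + g z)
  Poly-+ zero    (Level.lift f≈0) (Level.lift g≈0) =
    Level.lift λ z → trans (+-cong (f≈0 z) (g≈0 z)) (+-identityˡ 0#)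
  Poly-+ (suc n) F G w =
    let h , H , eqf = F w
        k , K , eqg = G w
    in (λ z → h z + k z) , Poly-+ n H K , λ z u z≈ →
       trans (+-cong (eqf z u z≈) (eqg z u z≈))
         (solve 5 (λ a b u c d →
           (a :+ u :* c) :+ (b :+ u :* d) := (a :+ b) :+ u :* (c :+ d))
           refl _ _ u (h z) (k z))

  Poly-scale : ∀ n {f} c → Poly n f → Poly n (λ z → c * f z)
  Poly-scale zero    c (Level.lift f≈0) =
    Level.lift λ z → trans (*-congˡ (f≈0 z)) (zeroʳ c)
  Poly-scale (suc n) c F w = let h , H , eq = F w in
    (λ z → c * h z) , Poly-scale n c H , λ z u z≈ →
      trans (*-congˡ (eq z u z≈))
        (solve 4 (λ c a u b → c :* (a :+ u :* b) := c :* a :+ u :* (c :* b))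
          refl c _ u (h z))

  Poly-suc : ∀ n {f} → Poly n f → Poly (suc n) f
  Poly-suc zero    (Level.lift f≈0) w =
    (λ _ → 0#) , Level.lift (λ _ → refl) , λ z u _ → begin
      _             ≈⟨ f≈0 z ⟩
      0#            ≈⟨ +-identityˡ 0# ⟨
      0# + 0#       ≈⟨ +-cong (f≈0 w) (zeroʳ u) ⟨
      _ + u * 0#    ∎
  Poly-suc (suc n) F w = let h , H , eq = F w in h , Poly-suc n H , eq

  Poly-mono : ∀ {m n f} → m ℕ.≤′ n → Poly m f → Poly n f
  Poly-mono (ℕ.≤′-reflexive ≡.refl) F = F
  Poly-mono (ℕ.≤′-step m≤n)         F = Poly-suc _ (Poly-mono m≤n F)

  Poly-zero : ∀ n → Poly n (λ _ → 0#)
  Poly-zero zero    = Level.lift λ _ → refl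
  Poly-zero (suc n) = Poly-suc n (Poly-zero n)

  Poly-const : ∀ n c → Poly (suc n) (λ _ → c)
  Poly-const n c w = (λ _ → 0#) , Poly-zero n , λ z u _ →
    solve 2 (λ c u → c := c :+ u :* con 0) refl c u

  -- The Leibniz rule for divided differences. Since `u` is a variable of its own, the identity
  -- contains no subtraction and falls to the semiring solver.
  Poly-shift : ∀ n {f} → Poly n f → Poly (suc n) (λ z → z * f z)
  Poly-shift zero    (Level.lift f≈0) w =
    (λ _ → 0#) , Level.lift (λ _ → refl) , λ z u _ → begin
      z * _               ≈⟨ *-congˡ (f≈0 z) ⟩
      z * 0#              ≈⟨ solve 3 (λ z w u → z :* con 0 := w :* con 0 :+ u :* con 0)
                               refl z w u ⟩
      w * 0# + u * 0#     ≈⟨ +-congʳ (*-congˡ (f≈0 w)) ⟨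
      w * _ + u * 0#      ∎
  Poly-shift (suc n) {f} F w = let h , H , eq = F w in
    (λ z → f z + w * h z) , Poly-+ (suc n) F (Poly-suc n (Poly-scale n w H)) ,
    λ z u z≈ → begin
      z * f z                               ≈⟨ *-cong z≈ (eq z u z≈) ⟩
      (w + u) * (f w + u * h z)             ≈⟨ solve 4 (λ w u a b →
                                                 (w :+ u) :* (a :+ u :* b) :=
                                                 w :* a :+ u :* ((a :+ u :* b) :+ w :* b))
                                                 refl w u (f w) (h z) ⟩
      w * f w + u * ((f w + u * h z) + w * h z) ≈⟨ +-congˡ (*-congˡ (+-congʳ (eq z u z≈))) ⟨
      w * f w + u * (f z + w * h z)         ∎

  Poly-horner : ∀ n {f} c → Poly n f → Poly (suc n) (λ z → c + z * f z)
  Poly-horner n c F = Poly-+ (suc n) (Poly-const n c) (Poly-shift n F)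

  NonZeroDivisor : Carrier → Set (a Level.⊔ ℓ)
  NonZeroDivisor u = ∀ y → u * y ≈ 0# → y ≈ 0#

  -- Removes one root at a time: as `f` vanishes at `x 0`, it is `z - x 0` times its divided
  -- difference, and the latter vanishes at the remaining points because their differences from
  -- `x 0` can be cancelled.
  vanishing : ∀ n {f} → Poly n f → (x : ℕ → Carrier) →
    (∀ {i j} → i ℕ.< j → ∃ λ u → x j ≈ x i + u × NonZeroDivisor u) →
    (∀ i → f (x i) ≈ 0#) → ∀ z → f z ≈ 0#
  vanishing zero    (Level.lift f≈0) _ _ _ = f≈0
  vanishing (suc n) {f} F x gap fx≈0 z = let g , G , eq = F (x 0) in begin
    f z                          ≈⟨ eq z (z - x 0) (sym (begin
      x 0 + (z - x 0)              ≈⟨ +-comm _ _ ⟩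
      (z - x 0) + x 0              ≈⟨ +-assoc z _ _ ⟩
      z + (- x 0 + x 0)            ≈⟨ +-congˡ (-‿inverseˡ (x 0)) ⟩
      z + 0#                       ≈⟨ +-identityʳ z ⟩
      z                            ∎)) ⟩
    f (x 0) + (z - x 0) * g z    ≈⟨ +-cong (fx≈0 0) (*-congˡ
      (vanishing n G (λ i → x (suc i)) (λ i<j → gap (ℕ.s≤s i<j))
        (λ i → let u , x≈ , nzd = gap {0} {suc i} (ℕ.s≤s ℕ.z≤n) in
          nzd (g (x (suc i))) (begin
            u * g (x (suc i))              ≈⟨ +-identityˡ _ ⟨
            0# + u * g (x (suc i))         ≈⟨ +-congʳ (fx≈0 0) ⟨
            f (x 0) + u * g (x (suc i))    ≈⟨ eq (x (suc i)) u x≈ ⟨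
            f (x (suc i))                  ≈⟨ fx≈0 (suc i) ⟩
            0#                             ∎)) z)) ⟩
    0# + (z - x 0) * 0#          ≈⟨ +-identityˡ _ ⟩
    (z - x 0) * 0#               ≈⟨ zeroʳ _ ⟩
    0#                           ∎

-- Falling factorials and the roots of descent polynomials

-- Here `suc N` is the binomial coefficient of `m + b` over `m` and `P` is the falling factorial;
-- both are given by equations between products, so that no division occurs.
falling-count : ∀ {m b N P} → suc N ℕ.* (m ! ℕ.* b !) ≡ (m ℕ.+ b) ! →
  P ℕ.* b ! ≡ (m ℕ.+ b) ! → m ! ℕ.* N ℕ.+ m ! ≡ P
falling-count {m} {b} {N} {P} N≡ P≡ =
  ℕ.*-cancelʳ-≡ (m ! ℕ.* N ℕ.+ m !) P (b !) {{ℕ.≢-nonZero λ b!≡0 → ℕ.<⇒≢ (ℕ.1≤n! b) (≡.sym b!≡0)}}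
    (≡.trans
      (solveℕ 3 (λ f n g → (f ⊗ n ⊕ f) ⊗ g ⊜ (κ 1 ⊕ n) ⊗ (f ⊗ g)) ≡.refl (m !) N (b !))
      (≡.trans N≡ (≡.sym P≡)))

module DescentRoots {a ℓ} (R : CommutativeRing a ℓ) where
  open CommutativeRing R
  open DividedDifference R
  open Algebra.Properties.Group +-group using (x∙y⁻¹≈ε⇒x≈y)
  open Algebra.Properties.Ring ring using (-1*x≈-x)
  open import Relation.Binary.Reasoning.Setoid setoid

  module _ (ν : ℕ → Carrier)
    (ν-+ : ∀ m n → ν (m ℕ.+ n) ≈ ν m + ν n)
    (ν-* : ∀ m n → ν (m ℕ.* n) ≈ ν m * ν n)
    (ν-nonZeroDivisor : ∀ n → NonZeroDivisor (ν (suc n)))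
    where

    falling : Carrier → ℕ → Carrier
    -- The empty product is `ν 1`, the image of the witness `P = 1` in `falling-ν`; the assumptions
    -- on `ν` do not state `ν 1 ≈ 1#`.
    falling z zero    = ν 1
    falling z (suc k) = (z - ν k) * falling z k

    falling-poly : ∀ m → Poly (suc m) (λ z → falling z m)
    falling-poly zero    = Poly-const 0 (ν 1)
    falling-poly (suc m) = Poly-cong (suc (suc m))
      (λ z → sym (distribʳ (falling z m) z (- ν m)))
      (Poly-+ (suc (suc m)) (Poly-shift (suc m) (falling-poly m))
        (Poly-suc (suc m) (Poly-scale (suc m) (- ν m) (falling-poly m))))

    -- The value is (m+b)!/b!. The induction trades `suc m` and `b` for `m` and `suc b`, which keeps
    -- the argument fixed and makes the new factor `ν (suc b)`.
    falling-ν : ∀ m b → ∃ λ P → P ℕ.* b ! ≡ (m ℕ.+ b) ! × falling (ν (m ℕ.+ b)) m ≈ ν P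
    falling-ν zero    b = 1 , ℕ.*-identityˡ (b !) , refl
    falling-ν (suc m) b =
      let P , P≡ , P≈ = falling-ν m (suc b)
          n = m ℕ.+ suc b
          step : falling (ν n) (suc m) ≈ ν (suc b ℕ.* P)
          step = begin
            (ν n - ν m) * falling (ν n) m    ≈⟨ *-cong (begin
              ν n - ν m                        ≈⟨ +-congʳ (ν-+ m (suc b)) ⟩
              (ν m + ν (suc b)) - ν m          ≈⟨ +-congʳ (+-comm (ν m) (ν (suc b))) ⟩
              (ν (suc b) + ν m) - ν m          ≈⟨ +-assoc (ν (suc b)) (ν m) (- ν m) ⟩
              ν (suc b) + (ν m - ν m)          ≈⟨ +-congˡ (-‿inverseʳ (ν m)) ⟩
              ν (suc b) + 0#                   ≈⟨ +-identityʳ (ν (suc b)) ⟩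
              ν (suc b)                        ∎) P≈ ⟩
            ν (suc b) * ν P                  ≈⟨ ν-* (suc b) P ⟨
            ν (suc b ℕ.* P)                  ∎
      in suc b ℕ.* P
       , ≡.trans (≡.trans (≡.cong (ℕ._* b !) (ℕ.*-comm (suc b) P)) (ℕ.*-assoc P (suc b) (b !)))
           (≡.trans P≡ (≡.cong _! (ℕ.+-suc m b)))
       , ≡.subst (λ n → falling (ν n) (suc m) ≈ ν (suc b ℕ.* P)) (ℕ.+-suc m b) step

    -- The polynomial m! f(z) + m! - z(z-1)⋯(z-m+1) vanishes at all large integers.
    root⇒falling : ∀ m {l f} → Poly l f →
      (∀ i → ∃ λ N → suc N ℕ.* (m ! ℕ.* suc i !) ≡ (m ℕ.+ suc i) ! ×
                     f (ν (m ℕ.+ suc i)) ≈ ν N) →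
      ∀ z → f z ≈ 0# → falling z m ≈ ν (m !)
    root⇒falling m {l} {f} F D z fz≈0 = sym (x∙y⁻¹≈ε⇒x≈y M (falling z m) (begin
      M - falling z m                               ≈⟨ +-cong (begin
        M                                             ≈⟨ +-identityˡ M ⟨
        0# + M                                        ≈⟨ +-congʳ (zeroʳ M) ⟨
        M * 0# + M                                    ≈⟨ +-congʳ (*-congˡ fz≈0) ⟨
        M * f z + M                            ∎) (sym (-1*x≈-x (falling z m))) ⟩
      q z                                           ≈⟨ vanishing degree q-poly x gap q-vanishes z ⟩
      0#                                            ∎))
      where
      M = ν (m !)

      q : Carrier → Carrier
      q z = (M * f z + M) + - 1# * falling z m

      -- No relation between `l` and `m` is known; the sum bounds the degrees of all three summands
      -- of `q`.
      degree = l ℕ.+ suc m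
      1+m≤degree = ℕ.≤⇒≤′ (ℕ.m≤n+m (suc m) l)

      q-poly : Poly degree q
      q-poly = Poly-+ degree
        (Poly-+ degree
          (Poly-scale degree M (Poly-mono (ℕ.≤⇒≤′ (ℕ.m≤m+n l (suc m))) F))
          (Poly-mono 1+m≤degree (Poly-const m M)))
        (Poly-scale degree (- 1#) (Poly-mono 1+m≤degree (falling-poly m)))

      x : ℕ → Carrier
      x i = ν (m ℕ.+ suc i)

      gap : ∀ {i j} → i ℕ.< j → ∃ λ u → x j ≈ x i + u × NonZeroDivisor u
      gap {i} i<j with ℕ.m≤n⇒∃[o]m+o≡n i<j
      ... | o , ≡.refl = ν (suc o) ,
        trans (reflexive (≡.cong ν (≡.trans (≡.cong (m ℕ.+_) (≡.sym (ℕ.+-suc (suc i) o)))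
                (≡.sym (ℕ.+-assoc m (suc i) (suc o))))))
          (ν-+ (m ℕ.+ suc i) (suc o)) ,
        ν-nonZeroDivisor o

      q-vanishes : ∀ i → q (x i) ≈ 0#
      q-vanishes i =
        let N , N≡ , fx≈N = D i
            P , P≡ , falling≈P = falling-ν m (suc i)
        in begin
          q (x i)                                    ≈⟨ +-cong (begin
            M * f (x i) + M                            ≈⟨ +-congʳ (*-congˡ fx≈N) ⟩
            M * ν N + M                                ≈⟨ +-congʳ (ν-* (m !) N) ⟨
            ν (m ! ℕ.* N) + M                          ≈⟨ ν-+ (m ! ℕ.* N) (m !) ⟨
            ν (m ! ℕ.* N ℕ.+ m !)                      ≡⟨ ≡.cong ν (falling-count {m} {suc i} N≡ P≡) ⟩
            ν P                                        ∎)
            (trans (-1*x≈-x (falling (x i) m)) (-‿cong falling≈P)) ⟩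
          ν P - ν P                                  ≈⟨ -‿inverseʳ (ν P) ⟩
          0#                                         ∎

open ≡ using (refl; sym; trans; cong; cong₂; subst; subst₂)

-- Permutations with at most one descent

open import Algebra.Properties.CommutativeMonoid.Sum ℕ.+-0-commutativeMonoid
  using (sum; sum-permute; sum-cong-≗)

DescentsOnlyAt : ∀ {n} → ℕ → Permutation′ n → Set
DescentsOnlyAt m π = ∀ j → IsDescent π j → j ≡ m

⟨$⟩ʳ-injective : ∀ {n} (π : Permutation′ n) {i j} → π ⟨$⟩ʳ i ≡ π ⟨$⟩ʳ j → i ≡ j
⟨$⟩ʳ-injective π eq = trans (sym (inverseˡ π)) (trans (cong (π ⟨$⟩ˡ_) eq) (inverseˡ π))

module _ {n m} (π : Permutation′ n) (only : DescentsOnlyAt m π) where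

  -- With positions counted from 0, a descent at `m` is the step that lands on position `m`; every
  -- other step goes up.
  increasing-step : ∀ a b → suc (toℕ a) ≡ toℕ b → toℕ b ≢ m →
                    π ⟨$⟩ʳ a Fin.< π ⟨$⟩ʳ b
  increasing-step a b sa≡b b≢m with Fin.<-cmp (π ⟨$⟩ʳ a) (π ⟨$⟩ʳ b)
  ... | tri< < _ _ = <
  ... | tri≈ _ ≡ _ = contradiction sa≡b
    λ e → ℕ.1+n≢n (trans e (cong toℕ (sym (⟨$⟩ʳ-injective π ≡))))
  ... | tri> _ _ > = contradiction (only (toℕ b) (a , b , sa≡b , refl , >)) b≢m

  -- Chains the steps from `a` to `b`. If `b` is before `m`, or `a` is at or after `m`, none of them
  -- lands on `m`.
  increasing-block : ∀ a b → suc (toℕ a) ℕ.≤′ toℕ b → toℕ b ℕ.< m ⊎ m ℕ.≤ toℕ a →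
                     π ⟨$⟩ʳ a Fin.< π ⟨$⟩ʳ b
  increasing-block a b a<b = go b refl a<b
    where
    go : ∀ {k} b → toℕ b ≡ k → suc (toℕ a) ℕ.≤′ k → toℕ b ℕ.< m ⊎ m ℕ.≤ toℕ a →
         π ⟨$⟩ʳ a Fin.< π ⟨$⟩ʳ b
    go b eq (ℕ.≤′-reflexive sa≡k) block = increasing-step a b (trans sa≡k (sym eq))
      λ b≡m → [ (λ b<m → ℕ.<⇒≢ b<m b≡m)
              , (λ m≤a → ℕ.<-irrefl (trans (sym b≡m) eq) (ℕ.≤-<-trans m≤a (ℕ.≤-reflexive sa≡k)))
              ]′ block
    go {suc k} b eq (ℕ.≤′-step a<k) block = ℕ.<-trans
      (go c c≡k a<k (Sum.map₁ (ℕ.<-trans c<b) block))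
      (increasing-step c b (trans (cong suc c≡k) (sym eq))
        λ b≡m → [ (λ b<m → ℕ.<⇒≢ b<m b≡m)
                , (λ m≤a → ℕ.<-irrefl (trans (sym b≡m) eq)
                     (ℕ.≤-<-trans m≤a (ℕ.m≤n⇒m≤1+n (ℕ.≤′⇒≤ a<k))))
                ]′ block)
      where
      k<n : k ℕ.< n
      k<n = ℕ.<-trans (ℕ.≤-reflexive (sym eq)) (Fin.toℕ<n b)
      c = fromℕ< k<n
      c≡k = Fin.toℕ-fromℕ< k<n
      c<b : toℕ c ℕ.< toℕ b
      c<b = ℕ.≤-reflexive (trans (cong suc c≡k) (sym eq))

inFirstBlock : ∀ {n} → ℕ → Permutation′ n → Fin n → Bool
inFirstBlock m π v = toℕ (π ⟨$⟩ˡ v) ℕ.<ᵇ m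

<ᵇ-true : ∀ {i m} → i ℕ.< m → (i ℕ.<ᵇ m) ≡ true
<ᵇ-true i<m = Equivalence.to T-≡ (ℕ.<⇒<ᵇ i<m)

<ᵇ-false : ∀ {i m} → m ℕ.≤ i → (i ℕ.<ᵇ m) ≡ false
<ᵇ-false {i} {m} m≤i with i ℕ.<ᵇ m in eq
... | false = refl
... | true  = contradiction m≤i (ℕ.<⇒≱ (ℕ.<ᵇ⇒< i m (Equivalence.from T-≡ eq)))

<ᵇ⇒<′ : ∀ {i j m} → (i ℕ.<ᵇ m) ≡ (j ℕ.<ᵇ m) → i ℕ.< m → j ℕ.< m
<ᵇ⇒<′ {i} {j} {m} eq i<m = ℕ.<ᵇ⇒< j m (Equivalence.from T-≡ (trans (sym eq) (<ᵇ-true i<m)))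

<ᵇ⇒≥′ : ∀ {i j m} → (i ℕ.<ᵇ m) ≡ (j ℕ.<ᵇ m) → m ℕ.≤ i → m ℕ.≤ j
<ᵇ⇒≥′ eq m≤i = ℕ.≮⇒≥ λ j<m → ℕ.<⇒≱ (<ᵇ⇒<′ (sym eq) j<m) m≤i

-- σ⁻¹ ∘ π increases on each block, so it moves no position to the left.
no-left-move : ∀ {n m} (π σ : Permutation′ n) →
  DescentsOnlyAt m π → DescentsOnlyAt m σ → inFirstBlock m π ≗ inFirstBlock m σ →
  ∀ i → toℕ i ℕ.≤ toℕ (σ ⟨$⟩ˡ (π ⟨$⟩ʳ i))
no-left-move {n} {m} π σ onlyπ onlyσ same i = go (toℕ i) i refl
  where
  τ : Fin n → Fin n
  τ i = σ ⟨$⟩ˡ (π ⟨$⟩ʳ i)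

  block : ∀ i → (toℕ i ℕ.<ᵇ m) ≡ (toℕ (τ i) ℕ.<ᵇ m)
  block i = trans (cong (λ k → toℕ k ℕ.<ᵇ m) (sym (inverseˡ π))) (same (π ⟨$⟩ʳ i))

  go : ∀ k i → toℕ i ≡ k → toℕ i ℕ.≤ toℕ (τ i)
  go zero    i eq = subst (ℕ._≤ toℕ (τ i)) (sym eq) ℕ.z≤n
  go (suc k) i eq with toℕ i ℕ.≟ m
  -- At the start of the second block the preceding position gives no information, but staying in
  -- the block is already the required bound.
  ... | yes i≡m = subst (ℕ._≤ toℕ (τ i)) (sym i≡m)
                    (<ᵇ⇒≥′ (block i) (ℕ.≤-reflexive (sym i≡m)))
  ... | no  i≢m = subst (ℕ._≤ toℕ (τ i)) sc≡i
                    (ℕ.≤-<-trans (go k c c≡k) τc<τi)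
    where
    k<n : k ℕ.< n
    k<n = ℕ.<-trans (ℕ.≤-reflexive (sym eq)) (Fin.toℕ<n i)
    c = fromℕ< k<n
    c≡k = Fin.toℕ-fromℕ< k<n
    sc≡i : suc (toℕ c) ≡ toℕ i
    sc≡i = trans (cong suc c≡k) (sym eq)
    πc<πi : π ⟨$⟩ʳ c Fin.< π ⟨$⟩ʳ i
    πc<πi = increasing-step π onlyπ c i sc≡i i≢m
    -- Phrased for the pair in the wrong order, `τ i` before `τ c`: this is the block condition
    -- under which `σ` would reverse `πc<πi`.
    same-block : toℕ (τ c) ℕ.< m ⊎ m ℕ.≤ toℕ (τ i)
    same-block with ℕ.<-≤-connex (toℕ i) m
    ... | inj₁ i<m = inj₁ (<ᵇ⇒<′ (block c) (ℕ.<-trans (ℕ.≤-reflexive sc≡i) i<m))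
    ... | inj₂ m≤i = inj₂ (<ᵇ⇒≥′ (block i) m≤i)
    τc<τi : τ c Fin.< τ i
    τc<τi with Fin.<-cmp (τ c) (τ i)
    ... | tri< < _ _ = <
    ... | tri≈ _ ≡ _ = contradiction
      (trans (sym (inverseʳ σ)) (trans (cong (σ ⟨$⟩ʳ_) ≡) (inverseʳ σ)))
      (Fin.<⇒≢ πc<πi)
    ... | tri> _ _ > = contradiction
      (subst₂ Fin._<_ (inverseʳ σ) (inverseʳ σ)
        (increasing-block σ onlyσ (τ i) (τ c) (ℕ.≤⇒≤′ >) same-block))
      (ℕ.<-asym πc<πi)

-- Neither σ⁻¹π nor its inverse moves a position to the left, so both are the identity. Hence the
-- set of values in the first block determines the permutation.
block-determines : ∀ {n m} (π σ : Permutation′ n) →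
  DescentsOnlyAt m π → DescentsOnlyAt m σ → inFirstBlock m π ≗ inFirstBlock m σ →
  π Perm.≈ σ
block-determines π σ onlyπ onlyσ same i = trans (sym (inverseʳ σ)) (cong (σ ⟨$⟩ʳ_) (sym i≡j))
  where
  j = σ ⟨$⟩ˡ (π ⟨$⟩ʳ i)
  i≡j : i ≡ j
  i≡j = Fin.toℕ-injective (ℕ.≤-antisym
    (no-left-move π σ onlyπ onlyσ same i)
    (subst (λ k → toℕ j ℕ.≤ toℕ k)
      (trans (cong (π ⟨$⟩ˡ_) (inverseʳ σ)) (inverseˡ π))
      (no-left-move σ π onlyσ onlyπ (sym ∘ same) j)))

-- Shuffles and the permutations they encode

-- The n values in increasing order, each assigned to the first block of a
-- positions (left) or to the second block of b positions (right).
data Shuffle : ℕ → ℕ → ℕ → Set where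
  []    : Shuffle 0 0 0
  left  : ∀ {a b n} → Shuffle a b n → Shuffle (suc a) b (suc n)
  right : ∀ {a b n} → Shuffle a b n → Shuffle a (suc b) (suc n)

-- The binomial coefficient of `n` over `a` if `a + b` is `n`, and 0 otherwise. Pascal's rule is
-- written as a sum over the two constructors of `Shuffle`, so that `Fin (size n a b)` splits
-- accordingly.
mutual
  size : ℕ → ℕ → ℕ → ℕ
  size zero    zero zero = 1
  size zero    _    _    = 0
  size (suc n) a    b    = sizeˡ n a b ℕ.+ sizeʳ n a b

  sizeˡ sizeʳ : ℕ → ℕ → ℕ → ℕ
  sizeˡ n zero    b = 0
  sizeˡ n (suc a) b = size n a b
  sizeʳ n a zero    = 0
  sizeʳ n a (suc b) = size n a b

rank : ∀ {a b n} → Shuffle a b n → Fin (size n a b)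
rank []                    = Fin.zero
rank (left {a} {b} {n} s)  = rank s ↑ˡ sizeʳ n (suc a) b
rank (right {a} {b} {n} s) = sizeˡ n a (suc b) ↑ʳ rank s

mutual
  unrank : ∀ n a b → Fin (size n a b) → Shuffle a b n
  unrank zero    zero    zero    _ = []
  unrank zero    zero    (suc b) ()
  unrank zero    (suc a) b       ()
  unrank (suc n) a b i = [ unrankˡ n a b , unrankʳ n a b ]′ (splitAt (sizeˡ n a b) i)

  unrankˡ : ∀ n a b → Fin (sizeˡ n a b) → Shuffle a b (suc n)
  unrankˡ n (suc a) b i = left (unrank n a b i)

  unrankʳ : ∀ n a b → Fin (sizeʳ n a b) → Shuffle a b (suc n)
  unrankʳ n a (suc b) i = right (unrank n a b i)

unrank-rank : ∀ {a b n} (s : Shuffle a b n) → unrank n a b (rank s) ≡ s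
unrank-rank []                    = refl
unrank-rank (left {a} {b} {n} s)
  rewrite Fin.splitAt-↑ˡ (size n a b) (rank s) (sizeʳ n (suc a) b) =
  cong left (unrank-rank s)
unrank-rank (right {a} {b} {n} s)
  rewrite Fin.splitAt-↑ʳ (sizeˡ n a (suc b)) (size n a b) (rank s) =
  cong right (unrank-rank s)

rank-unrank : ∀ n a b i → rank (unrank n a b i) ≡ i
rank-unrank zero    zero    zero    Fin.zero = refl
rank-unrank zero    zero    (suc b) ()
rank-unrank zero    (suc a) b       ()
rank-unrank (suc n) a b i = trans (go (splitAt (sizeˡ n a b) i))
  (Fin.join-splitAt (sizeˡ n a b) (sizeʳ n a b) i)
  where
  goˡ : ∀ a b i → rank (unrankˡ n a b i) ≡ i ↑ˡ sizeʳ n a b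
  goˡ (suc a) b i = cong (_↑ˡ sizeʳ n (suc a) b) (rank-unrank n a b i)
  goʳ : ∀ a b i → rank (unrankʳ n a b i) ≡ sizeˡ n a b ↑ʳ i
  goʳ a (suc b) i = cong (sizeˡ n a (suc b) ↑ʳ_) (rank-unrank n a b i)
  go : ∀ x → rank ([ unrankˡ n a b , unrankʳ n a b ]′ x) ≡ join (sizeˡ n a b) (sizeʳ n a b) x
  go (inj₁ i) = goˡ a b i
  go (inj₂ i) = goʳ a b i

-- After multiplication by the factorials, the two summands of Pascal's rule become `a` and `b`
-- copies of the previous factorial, `a + b` copies in all.
size-factorial : ∀ n a b → a ℕ.+ b ≡ n → size n a b ℕ.* (a ! ℕ.* b !) ≡ n !
size-factorial zero    zero    zero    _    = refl
size-factorial (suc n) zero    (suc b) eq = trans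
  (solveℕ 3 (λ s b f → s ⊗ (κ 1 ⊗ ((κ 1 ⊕ b) ⊗ f)) ⊜
                      (κ 1 ⊕ b) ⊗ (s ⊗ (κ 1 ⊗ f))) refl (size n 0 b) b (b !))
  (cong₂ ℕ._*_ eq (size-factorial n 0 b (ℕ.suc-injective eq)))
size-factorial (suc n) (suc a) zero    eq = trans
  (solveℕ 3 (λ s a f → (s ⊕ κ 0) ⊗ (((κ 1 ⊕ a) ⊗ f) ⊗ κ 1) ⊜
                      (κ 1 ⊕ a) ⊗ (s ⊗ (f ⊗ κ 1))) refl (size n a 0) a (a !))
  (cong₂ ℕ._*_ (trans (sym (ℕ.+-identityʳ (suc a))) eq)
    (size-factorial n a 0 (ℕ.suc-injective eq)))
size-factorial (suc n) (suc a) (suc b) eq = trans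
  (solveℕ 6 (λ s t a b f g →
     (s ⊕ t) ⊗ (((κ 1 ⊕ a) ⊗ f) ⊗ ((κ 1 ⊕ b) ⊗ g)) ⊜
     (κ 1 ⊕ a) ⊗ (s ⊗ (f ⊗ ((κ 1 ⊕ b) ⊗ g))) ⊕
     (κ 1 ⊕ b) ⊗ (t ⊗ (((κ 1 ⊕ a) ⊗ f) ⊗ g))) refl
     (size n a (suc b)) (size n (suc a) b) a b (a !) (b !))
  (trans (cong₂ (λ x y → suc a ℕ.* x ℕ.+ suc b ℕ.* y)
           (size-factorial n a (suc b) (ℕ.suc-injective eq))
           (size-factorial n (suc a) b (trans (sym (ℕ.+-suc a b)) (ℕ.suc-injective eq))))
    (trans (sym (ℕ.*-distribʳ-+ (n !) (suc a) (suc b))) (cong (ℕ._* n !) eq)))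

-- The argument is a place in one of the two blocks, the result the value standing there; `label` is
-- the inverse.
position : ∀ {a b n} → Shuffle a b n → Fin a ⊎ Fin b → Fin n
position (left s)  (inj₁ Fin.zero)    = Fin.zero
position (left s)  (inj₁ (Fin.suc i)) = Fin.suc (position s (inj₁ i))
position (left s)  (inj₂ j)           = Fin.suc (position s (inj₂ j))
position (right s) (inj₁ i)           = Fin.suc (position s (inj₁ i))
position (right s) (inj₂ Fin.zero)    = Fin.zero
position (right s) (inj₂ (Fin.suc j)) = Fin.suc (position s (inj₂ j))

label : ∀ {a b n} → Shuffle a b n → Fin n → Fin a ⊎ Fin b
label (left s)  Fin.zero    = inj₁ Fin.zero
label (left s)  (Fin.suc v) = Sum.map₁ Fin.suc (label s v)
label (right s) Fin.zero    = inj₂ Fin.zero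
label (right s) (Fin.suc v) = Sum.map₂ Fin.suc (label s v)

position-label : ∀ {a b n} (s : Shuffle a b n) v → position s (label s v) ≡ v
position-label (left s) Fin.zero = refl
position-label (left s) (Fin.suc v) with label s v | position-label s v
... | inj₁ i | eq = cong Fin.suc eq
... | inj₂ j | eq = cong Fin.suc eq
position-label (right s) Fin.zero = refl
position-label (right s) (Fin.suc v) with label s v | position-label s v
... | inj₁ i | eq = cong Fin.suc eq
... | inj₂ j | eq = cong Fin.suc eq

label-position : ∀ {a b n} (s : Shuffle a b n) x → label s (position s x) ≡ x
label-position (left s)  (inj₁ Fin.zero)    = refl
label-position (left s)  (inj₁ (Fin.suc i)) = cong (Sum.map₁ Fin.suc) (label-position s (inj₁ i))
label-position (left s)  (inj₂ j)           = cong (Sum.map₁ Fin.suc) (label-position s (inj₂ j))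
label-position (right s) (inj₁ i)           = cong (Sum.map₂ Fin.suc) (label-position s (inj₁ i))
label-position (right s) (inj₂ Fin.zero)    = refl
label-position (right s) (inj₂ (Fin.suc j)) = cong (Sum.map₂ Fin.suc) (label-position s (inj₂ j))

position-mono₁ : ∀ {a b n} (s : Shuffle a b n) {i j} → i Fin.< j →
                 position s (inj₁ i) Fin.< position s (inj₁ j)
position-mono₁ (left s) {Fin.zero}  {Fin.suc j} _   = ℕ.s≤s ℕ.z≤n
position-mono₁ (left s) {Fin.suc i} {Fin.suc j} i<j = ℕ.s≤s (position-mono₁ s (ℕ.s≤s⁻¹ i<j))
position-mono₁ (right s) i<j = ℕ.s≤s (position-mono₁ s i<j)

position-mono₂ : ∀ {a b n} (s : Shuffle a b n) {i j} → i Fin.< j →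
                 position s (inj₂ i) Fin.< position s (inj₂ j)
position-mono₂ (left s) i<j = ℕ.s≤s (position-mono₂ s i<j)
position-mono₂ (right s) {Fin.zero}  {Fin.suc j} _   = ℕ.s≤s ℕ.z≤n
position-mono₂ (right s) {Fin.suc i} {Fin.suc j} i<j = ℕ.s≤s (position-mono₂ s (ℕ.s≤s⁻¹ i<j))

toℕ-reduce≥ : ∀ m {n} (i : Fin (m ℕ.+ n)) .(m≤i : m ℕ.≤ toℕ i) →
              toℕ (Fin.reduce≥ i m≤i) ≡ toℕ i ℕ.∸ m
toℕ-reduce≥ zero    i           _   = refl
toℕ-reduce≥ (suc m) (Fin.suc i) m≤i = toℕ-reduce≥ m i (ℕ.s≤s⁻¹ m≤i)

decode : ∀ {m b} → Shuffle m b (m ℕ.+ b) → Permutation′ (m ℕ.+ b)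
decode {m} {b} s = permutation (position s ∘ splitAt m) (join m b ∘ label s)
  (λ v → trans (cong (position s) (Fin.splitAt-join m b (label s v))) (position-label s v))
  (λ i → trans (cong (join m b) (label-position s (splitAt m i))) (Fin.join-splitAt m b i))

-- Neighbouring places on the same side of `m` split into the same block, and on each block
-- `position` is increasing.
decode-descents : ∀ {m b} (s : Shuffle m b (m ℕ.+ b)) → DescentsOnlyAt m (decode s)
decode-descents {m} s j (x , y , sx≡j , y≡j , πy<πx) with ℕ.<-cmp j m
... | tri≈ _ j≡m _ = j≡m
... | tri< j<m _ _ = contradiction πy<πx (ℕ.<-asym
  (subst₂ (λ u w → position s u Fin.< position s w)
    (sym (Fin.splitAt-< m x x<m)) (sym (Fin.splitAt-< m y y<m))
    (position-mono₁ s (subst₂ ℕ._<_ (sym (Fin.toℕ-fromℕ< x<m)) (sym (Fin.toℕ-fromℕ< y<m)) x<y))))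
  where
  x<y : toℕ x ℕ.< toℕ y
  x<y = ℕ.≤-reflexive (trans sx≡j (sym y≡j))
  y<m = subst (ℕ._< m) (sym y≡j) j<m
  x<m = ℕ.<-trans x<y y<m
... | tri> _ _ m<j = contradiction πy<πx (ℕ.<-asym
  (subst₂ (λ u w → position s u Fin.< position s w)
    (sym (Fin.splitAt-≥ m x x≥m)) (sym (Fin.splitAt-≥ m y y≥m))
    (position-mono₂ s (subst₂ ℕ._<_ (sym (toℕ-reduce≥ m x x≥m)) (sym (toℕ-reduce≥ m y y≥m))
      (ℕ.∸-monoˡ-< x<y x≥m)))))
  where
  x<y : toℕ x ℕ.< toℕ y
  x<y = ℕ.≤-reflexive (trans sx≡j (sym y≡j))
  x≥m : m ℕ.≤ toℕ x
  x≥m = ℕ.s≤s⁻¹ (subst (m ℕ.<_) (sym sx≡j) m<j)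
  y≥m = ℕ.≤-trans x≥m (ℕ.<⇒≤ x<y)

isInj₁ : ∀ {A B : Set} → A ⊎ B → Bool
isInj₁ = [ (λ _ → true) , (λ _ → false) ]′

word : ∀ {a b n} → Shuffle a b n → Fin n → Bool
word (left s)  Fin.zero    = true
word (right s) Fin.zero    = false
word (left s)  (Fin.suc v) = word s v
word (right s) (Fin.suc v) = word s v

word-injective : ∀ {a b n} (s t : Shuffle a b n) → word s ≗ word t → s ≡ t
word-injective []        []        _  = refl
word-injective (left s)  (left t)  eq = cong left (word-injective s t (eq ∘ Fin.suc))
word-injective (left s)  (right t) eq = contradiction (eq Fin.zero) λ ()
word-injective (right s) (left t)  eq = contradiction (eq Fin.zero) λ ()
word-injective (right s) (right t) eq = cong right (word-injective s t (eq ∘ Fin.suc))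

isInj₁-label : ∀ {a b n} (s : Shuffle a b n) v → isInj₁ (label s v) ≡ word s v
isInj₁-label (left s)  Fin.zero    = refl
isInj₁-label (right s) Fin.zero    = refl
isInj₁-label (left s)  (Fin.suc v) with label s v | isInj₁-label s v
... | inj₁ _ | eq = eq
... | inj₂ _ | eq = eq
isInj₁-label (right s) (Fin.suc v) with label s v | isInj₁-label s v
... | inj₁ _ | eq = eq
... | inj₂ _ | eq = eq

inFirstBlock-decode : ∀ {m b} (s : Shuffle m b (m ℕ.+ b)) → inFirstBlock m (decode s) ≗ word s
inFirstBlock-decode {m} {b} s v = trans (go (label s v)) (isInj₁-label s v)
  where
  go : ∀ x → (toℕ (join m b x) ℕ.<ᵇ m) ≡ isInj₁ x
  go (inj₁ i) = <ᵇ-true (subst (ℕ._< m) (sym (Fin.toℕ-↑ˡ i b)) (Fin.toℕ<n i))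
  go (inj₂ j) = <ᵇ-false (subst (m ℕ.≤_) (sym (Fin.toℕ-↑ʳ m j)) (ℕ.m≤m+n m (toℕ j)))

inFirstBlock-cong : ∀ {n} m (π σ : Permutation′ n) → π Perm.≈ σ →
                    inFirstBlock m π ≗ inFirstBlock m σ
inFirstBlock-cong m π σ π≈σ v = cong (λ i → toℕ i ℕ.<ᵇ m)
  (⟨$⟩ʳ-injective π (trans (inverseʳ π) (sym (trans (π≈σ (σ ⟨$⟩ˡ v)) (inverseʳ σ)))))

decode-injective : ∀ {m b} (s t : Shuffle m b (m ℕ.+ b)) → decode s Perm.≈ decode t → s ≡ t
decode-injective {m} s t eq = word-injective s t λ v → trans (sym (inFirstBlock-decode s v))
  (trans (inFirstBlock-cong m (decode s) (decode t) eq v) (inFirstBlock-decode t v))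

indicator : Bool → ℕ
indicator true  = 1
indicator false = 0

count : ∀ {n} → (Fin n → Bool) → ℕ
count χ = sum (indicator ∘ χ)

-- The indices are sums of indicators because `count` unfolds to this form, so `fromWord` typechecks
-- without a case split on the first letter.
cons : ∀ {a b n} x → Shuffle a b n → Shuffle (indicator x ℕ.+ a) (indicator (not x) ℕ.+ b) (suc n)
cons true  s = left s
cons false s = right s

fromWord : ∀ {n} (χ : Fin n → Bool) → Shuffle (count χ) (count (not ∘ χ)) n
fromWord {zero}  χ = []
fromWord {suc n} χ = cons (χ Fin.zero) (fromWord (χ ∘ Fin.suc))

word-fromWord : ∀ {n} (χ : Fin n → Bool) → word (fromWord χ) ≗ χ
word-fromWord {suc n} χ Fin.zero with χ Fin.zero
... | true  = refl
... | false = refl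
word-fromWord {suc n} χ (Fin.suc v) with χ Fin.zero
... | true  = word-fromWord (χ ∘ Fin.suc) v
... | false = word-fromWord (χ ∘ Fin.suc) v

count-initial : ∀ m b → count {m ℕ.+ b} (λ i → toℕ i ℕ.<ᵇ m) ≡ m
count-initial zero    zero    = refl
count-initial zero    (suc b) = count-initial zero b
count-initial (suc m) b       = cong suc (count-initial m b)

count-final : ∀ m b → count {m ℕ.+ b} (λ i → not (toℕ i ℕ.<ᵇ m)) ≡ b
count-final zero    zero    = refl
count-final zero    (suc b) = cong suc (count-final zero b)
count-final (suc m) b       = count-final m b

-- A sum over values is reindexed by `π` into a sum over positions. Taking `id` or `not` for `f`
-- gives the sizes of the two blocks.
count-inFirstBlock : ∀ {n} m (f : Bool → Bool) (π : Permutation′ n) →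
  count (f ∘ inFirstBlock m π) ≡ count {n} (λ i → f (toℕ i ℕ.<ᵇ m))
count-inFirstBlock m f π = trans
  (sum-permute (indicator ∘ f ∘ inFirstBlock m π) π)
  (sum-cong-≗ {_} {indicator ∘ f ∘ inFirstBlock m π ∘ (π ⟨$⟩ʳ_)} λ i → cong (λ j → indicator (f (toℕ j ℕ.<ᵇ m))) (inverseˡ π))

word-subst₂ : ∀ {a a′ b b′ n} (p : a ≡ a′) (q : b ≡ b′) (s : Shuffle a b n) →
              word (subst₂ (λ a b → Shuffle a b n) p q s) ≗ word s
word-subst₂ refl refl s v = refl

encode : ∀ m b → Permutation′ (m ℕ.+ b) → Shuffle m b (m ℕ.+ b)
encode m b π = subst₂ (λ a c → Shuffle a c (m ℕ.+ b))
  (trans (count-inFirstBlock m id π) (count-initial m b))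
  (trans (count-inFirstBlock m not π) (count-final m b))
  (fromWord (inFirstBlock m π))

word-encode : ∀ m b (π : Permutation′ (m ℕ.+ b)) → word (encode m b π) ≗ inFirstBlock m π
word-encode m b π v = trans (word-subst₂
  (trans (count-inFirstBlock m id π) (count-initial m b))
  (trans (count-inFirstBlock m not π) (count-final m b)) (fromWord (inFirstBlock m π)) v)
  (word-fromWord (inFirstBlock m π) v)

encode-injective : ∀ m b (π σ : Permutation′ (m ℕ.+ b)) →
  DescentsOnlyAt m π → DescentsOnlyAt m σ →
  encode m b π ≡ encode m b σ → π Perm.≈ σ
encode-injective m b π σ onlyπ onlyσ eq = block-determines π σ onlyπ onlyσ
  λ v → trans (sym (word-encode m b π v)) (trans (cong (λ s → word s v) eq) (word-encode m b σ v))

-- The cardinality of a descent class with one descent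

isDescent? : ∀ {n} (π : Permutation′ n) j → Dec (IsDescent π j)
isDescent? π j = Fin.any? λ a → Fin.any? λ b →
  (suc (toℕ a) ℕ.≟ j) ×-dec (toℕ b ℕ.≟ j) ×-dec ((π ⟨$⟩ʳ b) Fin.<? (π ⟨$⟩ʳ a))

id-no-descent : ∀ {n} (π : Permutation′ n) → π Perm.≈ Perm.id → ∀ j → ¬ IsDescent π j
id-no-descent π π≈id j (a , b , sa≡j , b≡j , πb<πa) =
  ℕ.<-asym (ℕ.≤-reflexive (trans sa≡j (sym b≡j))) (subst₂ Fin._<_ (π≈id b) (π≈id a) πb<πa)

-- For `m = 0` the first block is empty, so `block-determines` identifies any two permutations
-- without descents.
no-descent-id : ∀ {n} (π : Permutation′ n) → (∀ j → ¬ IsDescent π j) → π Perm.≈ Perm.id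
no-descent-id π none = block-determines {m = 0} π Perm.id
  (λ j d → contradiction d (none j))
  (λ j d → contradiction d (id-no-descent Perm.id (λ _ → refl) j))
  (λ _ → refl)

descentClass-only : ∀ {n m} (π : Permutation′ n) → HasDescentSet π (m ∷ []) → DescentsOnlyAt m π
descentClass-only π D j d with Equivalence.to (D j) d
... | here eq = eq

module _ {m b N} (card : HasCardinality (DescentClass (m ∷ []) (m ℕ.+ b)) N) where
  open Inverse card

  permutationAt : Fin N → Permutation′ (m ℕ.+ b)
  permutationAt i = proj₁ (to i)

  only : ∀ i → DescentsOnlyAt m (permutationAt i)
  only i = descentClass-only (permutationAt i) (proj₂ (to i))

  -- The identity is the one permutation with descents at most at m which is
  -- missing from the descent class.
  toShuffle : Fin (suc N) → Shuffle m b (m ℕ.+ b)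
  toShuffle Fin.zero    = encode m b Perm.id
  toShuffle (Fin.suc i) = encode m b (permutationAt i)

  id-only : DescentsOnlyAt {m ℕ.+ b} m Perm.id
  id-only j d = contradiction d (id-no-descent Perm.id (λ _ → refl) j)

  notId : ∀ i → ¬ (permutationAt i Perm.≈ Perm.id)
  notId i eq = id-no-descent (permutationAt i) eq m (Equivalence.from (proj₂ (to i) m) (here refl))

  toShuffle-injective : Injective _≡_ _≡_ toShuffle
  toShuffle-injective {Fin.zero}  {Fin.zero}  _  = refl
  toShuffle-injective {Fin.zero}  {Fin.suc j} eq = contradiction
    (encode-injective m b _ _ (only j) id-only (sym eq)) (notId j)
  toShuffle-injective {Fin.suc i} {Fin.zero}  eq = contradiction
    (encode-injective m b _ _ (only i) id-only eq) (notId i)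
  toShuffle-injective {Fin.suc i} {Fin.suc j} eq = cong Fin.suc
    (trans (sym (strictlyInverseʳ i))
      (trans (from-cong (encode-injective m b _ _ (only i) (only j) eq)) (strictlyInverseʳ j)))

  classOf : (s : Shuffle m b (m ℕ.+ b)) → IsDescent (decode s) m →
            Σ (Permutation′ (m ℕ.+ b)) λ π → HasDescentSet π (m ∷ [])
  classOf s d = decode s , λ j → mk⇔ (λ d′ → here (decode-descents s j d′))
    λ { (here refl) → d }

  -- A shuffle whose permutation has no descent at `m` decodes to the identity, which `Fin.zero`
  -- represents here as in `toShuffle`.
  fromShuffle : Shuffle m b (m ℕ.+ b) → Fin (suc N)
  fromShuffle s with isDescent? (decode s) m
  ... | yes d = Fin.suc (from (classOf s d))
  ... | no  _ = Fin.zero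

  decode≈id : ∀ (s : Shuffle m b (m ℕ.+ b)) → ¬ IsDescent (decode s) m → decode s Perm.≈ Perm.id
  decode≈id s ¬d = no-descent-id (decode s)
    λ j d → ¬d (subst (IsDescent (decode s)) (decode-descents s j d) d)

  fromShuffle-injective : Injective _≡_ _≡_ fromShuffle
  fromShuffle-injective {s} {t} eq with isDescent? (decode s) m | isDescent? (decode t) m
  ... | yes d | yes d′ = decode-injective s t λ i →
    trans (sym (strictlyInverseˡ (classOf s d) i))
      (trans (to-cong (Fin.suc-injective eq) i) (strictlyInverseˡ (classOf t d′) i))
  ... | no ¬d | no ¬d′ = decode-injective s t λ i →
    trans (decode≈id s ¬d i) (sym (decode≈id t ¬d′ i))

  -- There are injections in both directions; `rank` and `unrank` turn them into injections between
  -- finite initial segments.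
  cardinality-size : suc N ≡ size (m ℕ.+ b) m b
  cardinality-size = ℕ.≤-antisym
    (Fin.injective⇒≤ {f = rank ∘ toShuffle} λ {i} {j} eq → toShuffle-injective
      (trans (sym (unrank-rank (toShuffle i)))
        (trans (cong (unrank (m ℕ.+ b) m b) eq) (unrank-rank (toShuffle j)))))
    (Fin.injective⇒≤ {f = fromShuffle ∘ unrank (m ℕ.+ b) m b} λ {i} {j} eq →
      trans (sym (rank-unrank (m ℕ.+ b) m b i))
        (trans (cong rank (fromShuffle-injective eq)) (rank-unrank (m ℕ.+ b) m b j)))

  cardinality-factorial : suc N ℕ.* (m ! ℕ.* b !) ≡ (m ℕ.+ b) !
  cardinality-factorial = trans (cong (ℕ._* (m ! ℕ.* b !)) cardinality-size)
    (size-factorial (m ℕ.+ b) m b refl)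

open import Data.Rational
  using (ℚ; 0ℚ; 1ℚ; ½; _+_; _*_; _-_; -_; ∣_∣; _≤_; _<_; _/_; nonNegative; positive)
import Data.Rational.Properties as ℚ
open import Data.Rational.Solver using (module +-*-Solver)
import Data.Rational.Unnormalised as ℚᵘ
import Data.Rational.Unnormalised.Properties as ℚᵘ

open +-*-Solver using (solve; _:+_; _:*_; _:-_; :-_; _:=_; con)

-- The ring of complex numbers

Eventually : (ℕ → Set) → Set
Eventually P = ∃ λ N → ∀ n → N ℕ.≤ n → P n

always : ∀ {P} → (∀ n → P n) → Eventually P
always p = 0 , λ n _ → p n

eventually₂ : ∀ {P Q R} → (∀ n → P n → Q n → R n) →
              Eventually P → Eventually Q → Eventually R
eventually₂ f (M , p) (N , q) = M ℕ.+ N , λ n ≤n →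
  f n (p n (ℕ.m+n≤o⇒m≤o M ≤n)) (q n (ℕ.m+n≤o⇒n≤o M ≤n))

-- `x ≈ℝ y` unfolds to `Null` of the termwise difference, so laws of real equality become closure
-- properties of null sequences.
Null : (ℕ → ℚ) → Set
Null s = ∀ ε → 0ℚ < ε → Eventually λ n → ∣ s n ∣ ≤ ε

Null-resp : ∀ {s t} → (∀ n → s n ≡ t n) → Null s → Null t
Null-resp s≗t h ε 0<ε = let N , f = h ε 0<ε in
  N , λ n ≤n → subst (λ q → ∣ q ∣ ≤ ε) (s≗t n) (f n ≤n)

Null-0 : Null λ _ → 0ℚ
Null-0 ε 0<ε = always λ _ → ℚ.<⇒≤ 0<ε

Null-neg : ∀ {s} → Null s → Null λ n → - s n
Null-neg {s} h ε 0<ε = let N , f = h ε 0<ε in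
  N , λ n ≤n → subst (_≤ ε) (sym (ℚ.∣-p∣≡∣p∣ (s n))) (f n ≤n)

Null-+ : ∀ {s t} → Null s → Null t → Null λ n → s n + t n
Null-+ {s} {t} h k ε 0<ε = eventually₂
  (λ n p q → ℚ.≤-trans (ℚ.∣p+q∣≤∣p∣+∣q∣ (s n) (t n))
    (subst (∣ s n ∣ + ∣ t n ∣ ≤_) (half+half ε) (ℚ.+-mono-≤ p q)))
  (h (ε * ½) (half 0<ε)) (k (ε * ½) (half 0<ε))

Null-scale : ∀ {s} (x : ℝ) → Null s → Null λ n → seq x n * s n
Null-scale {s} x h ε 0<ε =
  let B , M , 0<B , b = bounded x
  in eventually₂
    (λ n p q → subst₂ _≤_ (sym (ℚ.∣p*q∣≡∣p∣*∣q∣ (seq x n) (s n)))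
      (trans (solve 3 (λ b e i → b :* (e :* i) := e :* (b :* i)) refl B ε (inv B))
        (trans (cong (ε *_) (*-inv 0<B)) (ℚ.*-identityʳ ε)))
      (*-mono (ℚ.0≤∣p∣ (seq x n)) (ℚ.<⇒≤ (*-pos 0<ε (inv-pos 0<B))) p q))
    (M , b) (h (ε * inv B) (*-pos 0<ε (inv-pos 0<B)))

≗⇒≈ℝ : ∀ x y → (∀ n → seq x n ≡ seq y n) → x ≈ℝ y
≗⇒≈ℝ x y x≗y = Null-resp {λ _ → 0ℚ}
  (λ n → sym (trans (cong (_- seq y n) (x≗y n)) (ℚ.+-inverseʳ (seq y n)))) Null-0

≈ℝ-sym : ∀ x y → x ≈ℝ y → y ≈ℝ x
≈ℝ-sym x y h = Null-resp
  (λ n → solve 2 (λ a b → :- (a :- b) := b :- a) refl (seq x n) (seq y n)) (Null-neg h)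

≈ℝ-trans : ∀ x y z → x ≈ℝ y → y ≈ℝ z → x ≈ℝ z
≈ℝ-trans x y z h k = Null-resp
  (λ n → solve 3 (λ a b c → (a :- b) :+ (b :- c) := a :- c) refl
    (seq x n) (seq y n) (seq z n)) (Null-+ h k)

+ℝ-cong : ∀ x x′ y y′ → x ≈ℝ x′ → y ≈ℝ y′ → x +ℝ y ≈ℝ x′ +ℝ y′
+ℝ-cong x x′ y y′ h k = Null-resp
  (λ n → solve 4 (λ a b c d → (a :- b) :+ (c :- d) := (a :+ c) :- (b :+ d)) refl
    (seq x n) (seq x′ n) (seq y n) (seq y′ n)) (Null-+ h k)

-ℝ-cong : ∀ x x′ → x ≈ℝ x′ → -ℝ x ≈ℝ -ℝ x′
-ℝ-cong x x′ h = Null-resp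
  (λ n → solve 2 (λ a b → :- (a :- b) := :- a :- :- b) refl (seq x n) (seq x′ n))
  (Null-neg h)

*ℝ-cong : ∀ x x′ y y′ → x ≈ℝ x′ → y ≈ℝ y′ → x *ℝ y ≈ℝ x′ *ℝ y′
*ℝ-cong x x′ y y′ h k = Null-resp
  (λ n → solve 4 (λ a b c d → a :* (c :- d) :+ d :* (a :- b) := a :* c :- b :* d) refl
    (seq x n) (seq x′ n) (seq y n) (seq y′ n))
  (Null-+ (Null-scale x k) (Null-scale y′ h))

-ℂ_ : ℂ → ℂ
-ℂ z = (-ℝ re z) +i (-ℝ im z)

1ℂ : ℂ
1ℂ = 1ℝ +i 0ℝ

≗⇒≈ℂ : ∀ {w z} → (∀ n → seq (re w) n ≡ seq (re z) n) →
       (∀ n → seq (im w) n ≡ seq (im z) n) → w ≈ℂ z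
≗⇒≈ℂ {w} {z} h k = ≗⇒≈ℝ (re w) (re z) h , ≗⇒≈ℝ (im w) (im z) k

-- The operations act termwise, so each algebraic axiom is a rational identity at every index;
-- limits enter only through symmetry, transitivity and the congruences.
ℂ-commutativeRing : CommutativeRing 0ℓ 0ℓ
ℂ-commutativeRing = record
  { Carrier = ℂ ; _≈_ = _≈ℂ_ ; _+_ = _+ℂ_ ; _*_ = _*ℂ_ ; -_ = -ℂ_ ; 0# = 0ℂ ; 1# = 1ℂ
  ; isCommutativeRing = record
    { isRing = record
      { +-isAbelianGroup = record
        { isGroup = record
          { isMonoid = record
            { isSemigroup = record
              { isMagma = record
                { isEquivalence = record
                  { refl  = λ {z} → ≗⇒≈ℂ {z} {z} (λ _ → refl) (λ _ → refl)
                  ; sym   = λ {w} {z} (h , k) →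
                      ≈ℝ-sym (re w) (re z) h , ≈ℝ-sym (im w) (im z) k
                  ; trans = λ {u} {w} {z} (h , k) (h′ , k′) →
                      ≈ℝ-trans (re u) (re w) (re z) h h′ ,
                      ≈ℝ-trans (im u) (im w) (im z) k k′
                  }
                ; ∙-cong = λ {w} {w′} {z} {z′} (h , k) (h′ , k′) →
                    +ℝ-cong (re w) (re w′) (re z) (re z′) h h′ ,
                    +ℝ-cong (im w) (im w′) (im z) (im z′) k k′
                }
              ; assoc = λ u w z → ≗⇒≈ℂ {(u +ℂ w) +ℂ z} {u +ℂ (w +ℂ z)}
                  (λ n → ℚ.+-assoc (seq (re u) n) (seq (re w) n) (seq (re z) n))
                  (λ n → ℚ.+-assoc (seq (im u) n) (seq (im w) n) (seq (im z) n))
              }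
            ; identity =
                (λ z → ≗⇒≈ℂ {0ℂ +ℂ z} {z} (λ n → ℚ.+-identityˡ (seq (re z) n))
                                          (λ n → ℚ.+-identityˡ (seq (im z) n))) ,
                (λ z → ≗⇒≈ℂ {z +ℂ 0ℂ} {z} (λ n → ℚ.+-identityʳ (seq (re z) n))
                                          (λ n → ℚ.+-identityʳ (seq (im z) n)))
            }
          ; inverse =
              (λ z → ≗⇒≈ℂ {(-ℂ z) +ℂ z} {0ℂ} (λ n → ℚ.+-inverseˡ (seq (re z) n))
                                             (λ n → ℚ.+-inverseˡ (seq (im z) n))) ,
              (λ z → ≗⇒≈ℂ {z +ℂ (-ℂ z)} {0ℂ} (λ n → ℚ.+-inverseʳ (seq (re z) n))
                                             (λ n → ℚ.+-inverseʳ (seq (im z) n)))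
          ; ⁻¹-cong = λ {w} {z} (h , k) →
              -ℝ-cong (re w) (re z) h , -ℝ-cong (im w) (im z) k
          }
        ; comm = λ w z → ≗⇒≈ℂ {w +ℂ z} {z +ℂ w}
            (λ n → ℚ.+-comm (seq (re w) n) (seq (re z) n))
            (λ n → ℚ.+-comm (seq (im w) n) (seq (im z) n))
        }
      ; *-cong = λ {w} {w′} {z} {z′} (h , k) (h′ , k′) →
          +ℝ-cong (re w *ℝ re z) (re w′ *ℝ re z′)
                  (-ℝ (im w *ℝ im z)) (-ℝ (im w′ *ℝ im z′))
            (*ℝ-cong (re w) (re w′) (re z) (re z′) h h′)
            (-ℝ-cong (im w *ℝ im z) (im w′ *ℝ im z′)
              (*ℝ-cong (im w) (im w′) (im z) (im z′) k k′)) ,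
          +ℝ-cong (re w *ℝ im z) (re w′ *ℝ im z′) (im w *ℝ re z) (im w′ *ℝ re z′)
            (*ℝ-cong (re w) (re w′) (im z) (im z′) h k′)
            (*ℝ-cong (im w) (im w′) (re z) (re z′) k h′)
      ; *-assoc = λ u w z → ≗⇒≈ℂ {(u *ℂ w) *ℂ z} {u *ℂ (w *ℂ z)}
          (λ n → solve 6 (λ a b c d e f →
             (a :* c :- b :* d) :* e :- (a :* d :+ b :* c) :* f :=
             a :* (c :* e :- d :* f) :- b :* (c :* f :+ d :* e)) refl
             (seq (re u) n) (seq (im u) n) (seq (re w) n) (seq (im w) n)
             (seq (re z) n) (seq (im z) n))
          (λ n → solve 6 (λ a b c d e f →
             (a :* c :- b :* d) :* f :+ (a :* d :+ b :* c) :* e :=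
             a :* (c :* f :+ d :* e) :+ b :* (c :* e :- d :* f)) refl
             (seq (re u) n) (seq (im u) n) (seq (re w) n) (seq (im w) n)
             (seq (re z) n) (seq (im z) n))
      ; *-identity =
          (λ z → ≗⇒≈ℂ {1ℂ *ℂ z} {z}
             (λ n → solve 2 (λ a b → con 1ℚ :* a :- con 0ℚ :* b := a) refl
                (seq (re z) n) (seq (im z) n))
             (λ n → solve 2 (λ a b → con 1ℚ :* b :+ con 0ℚ :* a := b) refl
                (seq (re z) n) (seq (im z) n))) ,
          (λ z → ≗⇒≈ℂ {z *ℂ 1ℂ} {z}
             (λ n → solve 2 (λ a b → a :* con 1ℚ :- b :* con 0ℚ := a) refl
                (seq (re z) n) (seq (im z) n))
             (λ n → solve 2 (λ a b → a :* con 0ℚ :+ b :* con 1ℚ := b) refl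
                (seq (re z) n) (seq (im z) n)))
      ; distrib =
          (λ u w z → ≗⇒≈ℂ {u *ℂ (w +ℂ z)} {u *ℂ w +ℂ u *ℂ z}
            (λ n → solve 6 (λ a b c d e f →
               a :* (c :+ e) :- b :* (d :+ f) :=
               (a :* c :- b :* d) :+ (a :* e :- b :* f)) refl
               (seq (re u) n) (seq (im u) n) (seq (re w) n) (seq (im w) n)
               (seq (re z) n) (seq (im z) n))
            (λ n → solve 6 (λ a b c d e f →
               a :* (d :+ f) :+ b :* (c :+ e) :=
               (a :* d :+ b :* c) :+ (a :* f :+ b :* e)) refl
               (seq (re u) n) (seq (im u) n) (seq (re w) n) (seq (im w) n)
               (seq (re z) n) (seq (im z) n))) ,
          (λ u w z → ≗⇒≈ℂ {(w +ℂ z) *ℂ u} {w *ℂ u +ℂ z *ℂ u}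
            (λ n → solve 6 (λ a b c d e f →
               (c :+ e) :* a :- (d :+ f) :* b :=
               (c :* a :- d :* b) :+ (e :* a :- f :* b)) refl
               (seq (re u) n) (seq (im u) n) (seq (re w) n) (seq (im w) n)
               (seq (re z) n) (seq (im z) n))
            (λ n → solve 6 (λ a b c d e f →
               (c :+ e) :* b :+ (d :+ f) :* a :=
               (c :* b :+ d :* a) :+ (e :* b :+ f :* a)) refl
               (seq (re u) n) (seq (im u) n) (seq (re w) n) (seq (im w) n)
               (seq (re z) n) (seq (im z) n)))
      }
    ; *-comm = λ w z → ≗⇒≈ℂ {w *ℂ z} {z *ℂ w}
        (λ n → solve 4 (λ a b c d → a :* c :- b :* d := c :* a :- d :* b) refl
           (seq (re w) n) (seq (im w) n) (seq (re z) n) (seq (im z) n))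
        (λ n → solve 4 (λ a b c d → a :* d :+ b :* c := c :* b :+ d :* a) refl
           (seq (re w) n) (seq (im w) n) (seq (re z) n) (seq (im z) n))
    }
  }

-- The bound on the factorial

ι : ℕ → ℚ
ι n = + n / 1

ι-+ : ∀ a b → ι (a ℕ.+ b) ≡ ι a + ι b
ι-+ a b = ℚ.toℚᵘ-injective (ℚᵘ.≃-trans (toℚᵘ-/ (a ℕ.+ b) 0) (ℚᵘ.≃-sym
  (ℚᵘ.≃-trans (ℚ.toℚᵘ-homo-+ (ι a) (ι b))
  (ℚᵘ.≃-trans (ℚᵘ.+-cong (toℚᵘ-/ a 0) (toℚᵘ-/ b 0))
    (ℚᵘ.*≡* (cong (ℤ._* + 1)
      (cong₂ ℤ._+_ (ℤ.*-identityʳ (+ a)) (ℤ.*-identityʳ (+ b)))))))))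

ι-* : ∀ a b → ι (a ℕ.* b) ≡ ι a * ι b
ι-* zero    b = sym (ℚ.*-zeroˡ (ι b))
ι-* (suc a) b = trans (ι-+ b (a ℕ.* b)) (trans (cong (_+_ (ι b)) (ι-* a b))
  (trans (solve 2 (λ x y → y :+ x :* y := (con 1ℚ :+ x) :* y) refl (ι a) (ι b))
    (cong (_* ι b) (sym (ι-+ 1 a)))))

ι-suc : ∀ n → ι (suc n) ≡ ι n + 1ℚ
ι-suc n = trans (ι-+ 1 n) (ℚ.+-comm 1ℚ (ι n))

ι-nonNeg : ∀ n → 0ℚ ≤ ι n
ι-nonNeg n = grid-nonNeg 0 n

ι-mono : ∀ {a b} → a ℕ.≤ b → ι a ≤ ι b
ι-mono {a} {b} a≤b = subst (ι a ≤_)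
  (trans (sym (ι-+ a (b ℕ.∸ a))) (cong ι (ℕ.m+[n∸m]≡n a≤b))) (≤-step (ι-nonNeg (b ℕ.∸ a)))

1≤ι : ∀ n → 1ℚ ≤ ι (suc n)
1≤ι n = ι-mono {1} {suc n} (ℕ.s≤s ℕ.z≤n)

ι-suc-pos : ∀ n → 0ℚ < ι (suc n)
ι-suc-pos n = ℚ.<-≤-trans 0<1 (1≤ι n)

ι*unit : ∀ n → ι (suc n) * unit n ≡ 1ℚ
ι*unit n = ℚ.toℚᵘ-injective
  (ℚᵘ.≃-trans (ℚ.toℚᵘ-homo-* (ι (suc n)) (unit n))
  (ℚᵘ.≃-trans (ℚᵘ.*-cong (toℚᵘ-/ (suc n) 0) (toℚᵘ-/ 1 n))
    (ℚᵘ.*≡* (trans (ℤ.*-identityʳ _) (trans (ℤ.*-identityʳ _)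
       (sym (trans (ℤ.*-identityˡ _) (cong +_ (ℕ.*-identityˡ (suc n))))))))))

*-monoʳ : ∀ {p q} r → 0ℚ ≤ r → p ≤ q → p * r ≤ q * r
*-monoʳ r 0≤r = ℚ.*-monoʳ-≤-nonNeg r {{nonNegative 0≤r}}

*-monoˡ : ∀ {p q} r → 0ℚ ≤ r → p ≤ q → r * p ≤ r * q
*-monoˡ r 0≤r = ℚ.*-monoˡ-≤-nonNeg r {{nonNegative 0≤r}}

^-distrib-* : ∀ p q n → (p * q) ^ℚ n ≡ p ^ℚ n * q ^ℚ n
^-distrib-* p q zero    = refl
^-distrib-* p q (suc n) = trans (cong (p * q *_) (^-distrib-* p q n))
  (solve 4 (λ p q a b → p :* q :* (a :* b) := p :* a :* (q :* b)) refl
    p q (p ^ℚ n) (q ^ℚ n))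

1^ : ∀ n → 1ℚ ^ℚ n ≡ 1ℚ
1^ zero    = refl
1^ (suc n) = trans (ℚ.*-identityˡ (1ℚ ^ℚ n)) (1^ n)

-- The Taylor polynomial of exp. Its variable argument lets the point 1 be reached from 0 in many
-- small steps.
expPoly : ℕ → ℚ → ℚ
expPoly zero    s = 1ℚ
expPoly (suc n) s = expPoly n s + invFactorial (suc n) * s ^ℚ suc n

expPoly-1 : ∀ n → expPoly n 1ℚ ≡ expSum n
expPoly-1 zero    = refl
expPoly-1 (suc n) = cong₂ _+_ (expPoly-1 n)
  (trans (cong (invFactorial (suc n) *_) (1^ (suc n))) (ℚ.*-identityʳ _))

expPoly-0 : ∀ n → expPoly n 0ℚ ≡ 1ℚ
expPoly-0 zero    = refl
expPoly-0 (suc n) = trans (cong₂ _+_ (expPoly-0 n)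
  (trans (cong (invFactorial (suc n) *_) (ℚ.*-zeroˡ (0ℚ ^ℚ n)))
    (ℚ.*-zeroʳ (invFactorial (suc n))))) (ℚ.+-identityʳ 1ℚ)

-- A mean value estimate: the derivative of the power is taken at the larger end `t + x`.
^-increment : ∀ n {t x} → 0ℚ ≤ t → 0ℚ ≤ x →
  (t + x) ^ℚ suc n ≤ t ^ℚ suc n + ι (suc n) * (x * (t + x) ^ℚ n)
^-increment zero    {t} {x} _ _ = ℚ.≤-reflexive
  (solve 2 (λ t x → (t :+ x) :* con 1ℚ := t :* con 1ℚ :+ con 1ℚ :* (x :* con 1ℚ)) refl t x)
^-increment (suc n) {t} {x} 0≤t 0≤x = begin
  s * S                                   ≤⟨ *-monoˡ s 0≤s (^-increment n 0≤t 0≤x) ⟩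
  s * (T + ι (suc n) * (x * P))           ≡⟨ solve 5 (λ t x T k P →
                                               (t :+ x) :* (T :+ k :* (x :* P)) :=
                                               (t :* T :+ k :* (x :* ((t :+ x) :* P))) :+ x :* T)
                                               refl t x T (ι (suc n)) P ⟩
  (t * T + ι (suc n) * (x * S)) + x * T   ≤⟨ ℚ.+-monoʳ-≤ (t * T + ι (suc n) * (x * S))
                                               (*-monoˡ x 0≤x (^-mono (suc n) 0≤t (≤-step 0≤x))) ⟩
  (t * T + ι (suc n) * (x * S)) + x * S   ≡⟨ solve 3 (λ a k y →
                                               (a :+ k :* y) :+ y := a :+ (k :+ con 1ℚ) :* y)
                                               refl (t * T) (ι (suc n)) (x * S) ⟩
  t * T + (ι (suc n) + 1ℚ) * (x * S)      ≡⟨ cong (λ k → t * T + k * (x * S)) (ι-suc (suc n)) ⟨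
  t * T + ι (suc (suc n)) * (x * S)       ∎
  where
  open ℚ.≤-Reasoning
  s = t + x
  0≤s = ℚ.≤-trans 0≤t (≤-step 0≤x)
  S = s ^ℚ suc n
  T = t ^ℚ suc n
  P = s ^ℚ n

expPoly-term : ∀ n {t x} → 0ℚ ≤ t → 0ℚ ≤ x →
  invFactorial (suc n) * (t + x) ^ℚ suc n ≤
  invFactorial (suc n) * t ^ℚ suc n + x * (invFactorial n * (t + x) ^ℚ n)
expPoly-term n {t} {x} 0≤t 0≤x = begin
  f * unit n * S                                   ≤⟨ *-monoˡ (f * unit n)
                                                        (ℚ.<⇒≤ (invFactorial-pos (suc n)))
                                                        (^-increment n 0≤t 0≤x) ⟩
  f * unit n * (T + ι (suc n) * (x * P))           ≡⟨ solve 6 (λ f u T k x P →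
                                                        f :* u :* (T :+ k :* (x :* P)) :=
                                                        f :* u :* T :+ (k :* u) :* (x :* (f :* P)))
                                                        refl f (unit n) T (ι (suc n)) x P ⟩
  f * unit n * T + (ι (suc n) * unit n) * (x * (f * P)) ≡⟨ cong (_+_ (f * unit n * T))
                                                        (trans (cong (_* (x * (f * P))) (ι*unit n))
                                                          (ℚ.*-identityˡ (x * (f * P)))) ⟩
  f * unit n * T + x * (f * P)                     ∎
  where
  open ℚ.≤-Reasoning
  f = invFactorial n
  S = (t + x) ^ℚ suc n
  T = t ^ℚ suc n
  P = (t + x) ^ℚ n

-- The same estimate summed over all terms; the derivative of `expPoly (suc n)` is `expPoly n`.
expPoly-increment : ∀ n {t x} → 0ℚ ≤ t → 0ℚ ≤ x →
  expPoly (suc n) (t + x) ≤ expPoly (suc n) t + x * expPoly n (t + x)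
expPoly-increment zero    {t} {x} 0≤t 0≤x =
  ℚ.≤-trans (ℚ.+-monoʳ-≤ 1ℚ (expPoly-term 0 0≤t 0≤x))
    (ℚ.≤-reflexive (solve 2 (λ a x → con 1ℚ :+ (a :+ x :* (con 1ℚ :* con 1ℚ)) :=
                                      con 1ℚ :+ a :+ x :* con 1ℚ)
      refl (invFactorial 1 * t ^ℚ 1) x))
expPoly-increment (suc n) {t} {x} 0≤t 0≤x =
  ℚ.≤-trans (ℚ.+-mono-≤ (expPoly-increment n 0≤t 0≤x) (expPoly-term (suc n) 0≤t 0≤x))
    (ℚ.≤-reflexive (solve 5 (λ a b c d x →
      (a :+ x :* b) :+ (c :+ x :* d) := (a :+ c) :+ x :* (b :+ d)) refl
      (expPoly (suc n) t) (expPoly n (t + x)) (invFactorial (suc (suc n)) * t ^ℚ suc (suc n))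
      (invFactorial (suc n) * (t + x) ^ℚ suc n) x))

-- The inequality exp(x)(1-x) ≤ 1 in truncated form. The mean value estimate lowers the degree on
-- the right, and `E-mono` restores it, so that both sides involve the same polynomial.
expPoly-step : ∀ n {t x} → 0ℚ ≤ t → 0ℚ ≤ x →
  expPoly n (t + x) * (1ℚ - x) ≤ expPoly n t
expPoly-step n {t} {x} 0≤t 0≤x = ℚ.≤-trans
  (ℚ.≤-reflexive (solve 2 (λ E x → E :* (con 1ℚ :- x) := E :+ :- (x :* E)) refl (E n) x))
  (ℚ.≤-trans (ℚ.+-monoˡ-≤ (- (x * E n)) (bound n))
    (ℚ.≤-reflexive (solve 2 (λ a y → (a :+ y) :+ :- y := a) refl (expPoly n t) (x * E n))))
  where
  E : ℕ → ℚ
  E n = expPoly n (t + x)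
  0≤s = ℚ.≤-trans 0≤t (≤-step {t} {x} 0≤x)
  E-nonNeg : ∀ n → 0ℚ ≤ E n
  E-mono : ∀ n → E n ≤ E (suc n)
  E-mono n = ≤-step (*-nonNeg (ℚ.<⇒≤ (invFactorial-pos (suc n))) (^-nonNeg (suc n) 0≤s))
  E-nonNeg zero    = ℚ.<⇒≤ 0<1
  E-nonNeg (suc n) = ℚ.≤-trans (E-nonNeg n) (E-mono n)
  bound : ∀ n → E n ≤ expPoly n t + x * E n
  bound zero    = ≤-step (*-nonNeg 0≤x (ℚ.<⇒≤ 0<1))
  bound (suc n) = ℚ.≤-trans (expPoly-increment n 0≤t 0≤x)
    (ℚ.+-monoʳ-≤ (expPoly (suc n) t) (*-monoˡ x 0≤x (E-mono n)))

expPoly-iterate : ∀ n j {x} → 0ℚ ≤ x → 0ℚ ≤ 1ℚ - x →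
  expPoly n (ι j * x) * (1ℚ - x) ^ℚ j ≤ 1ℚ
expPoly-iterate n zero    {x} _ _ = ℚ.≤-reflexive
  (trans (ℚ.*-identityʳ _) (trans (cong (expPoly n) (ℚ.*-zeroˡ x)) (expPoly-0 n)))
expPoly-iterate n (suc j) {x} 0≤x 0≤1-x = begin
  expPoly n (ι (suc j) * x) * (y * Y)     ≡⟨ cong (λ s → expPoly n s * (y * Y))
                                               (trans (cong (_* x) (ι-suc j))
                                                 (solve 2 (λ k x → (k :+ con 1ℚ) :* x := k :* x :+ x)
                                                   refl (ι j) x)) ⟩
  expPoly n (ι j * x + x) * (y * Y)       ≡⟨ ℚ.*-assoc (expPoly n (ι j * x + x)) y Y ⟨
  expPoly n (ι j * x + x) * y * Y         ≤⟨ *-monoʳ Y (^-nonNeg j 0≤1-x)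
                                               (expPoly-step n (*-nonNeg (ι-nonNeg j) 0≤x) 0≤x) ⟩
  expPoly n (ι j * x) * Y                 ≤⟨ expPoly-iterate n j 0≤x 0≤1-x ⟩
  1ℚ                                      ∎
  where
  open ℚ.≤-Reasoning
  y = 1ℚ - x
  Y = y ^ℚ j

-- e (1 - 1/(m+1))^(m+1) ≤ 1, with the denominator cleared.
expSum-ratio : ∀ n m → expSum n * ι m ^ℚ suc m ≤ ι (suc m) ^ℚ suc m
expSum-ratio n m = begin
  E * ι m ^ℚ suc m                          ≡⟨ cong (λ q → E * q ^ℚ suc m) m≡ ⟩
  E * (M * y) ^ℚ suc m                      ≡⟨ cong (E *_) (^-distrib-* M y (suc m)) ⟩
  E * (M ^ℚ suc m * y ^ℚ suc m)             ≡⟨ solve 3 (λ a b c → a :* (b :* c) := b :* (a :* c))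
                                                 refl E (M ^ℚ suc m) (y ^ℚ suc m) ⟩
  -- `M * unit m` is 1, so `E` is the Taylor polynomial after `suc m` steps of length `unit m`.
  M ^ℚ suc m * (E * y ^ℚ suc m)             ≡⟨ cong (λ q → M ^ℚ suc m * (q * y ^ℚ suc m))
                                                 (trans (sym (expPoly-1 n))
                                                   (cong (expPoly n) (sym (ι*unit m)))) ⟩
  M ^ℚ suc m * (expPoly n (M * unit m) * y ^ℚ suc m) ≤⟨ *-monoˡ (M ^ℚ suc m)
                                                 (^-nonNeg (suc m) (ι-nonNeg (suc m)))
                                                 (expPoly-iterate n (suc m)
                                                   (ℚ.<⇒≤ (unit-pos m)) 0≤y) ⟩
  M ^ℚ suc m * 1ℚ                           ≡⟨ ℚ.*-identityʳ (M ^ℚ suc m) ⟩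
  M ^ℚ suc m                                ∎
  where
  open ℚ.≤-Reasoning
  E = expSum n
  M = ι (suc m)
  y = 1ℚ - unit m
  0≤y : 0ℚ ≤ y
  0≤y = subst (_≤ y) (ℚ.+-inverseʳ (unit m)) (ℚ.+-monoˡ-≤ (- unit m) (unit≤1 m))
  m≡ : ι m ≡ M * y
  m≡ = sym (trans (solve 2 (λ M u → M :* (con 1ℚ :- u) := M :- M :* u) refl M (unit m))
    (trans (cong₂ _-_ (ι-suc m) (ι*unit m))
      (solve 1 (λ k → (k :+ con 1ℚ) :- con 1ℚ := k) refl (ι m))))

-- The tail estimate started at index 1: the sum 1 + 1 with its last term counted once more.
expSum≤3 : ∀ n → expSum n ≤ ι 3
expSum≤3 n = ℚ.≤-trans (expSum-mono {n} {suc n} (ℕ.≤′-step (ℕ.≤′-reflexive refl)))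
  (ℚ.≤-trans (≤-step (ℚ.<⇒≤ (invFactorial-pos (suc n))))
    (expSum-bound {0} {suc n} (ℕ.≤⇒≤′ (ℕ.s≤s ℕ.z≤n))))

1≤expSum : ∀ n → 1ℚ ≤ expSum n
1≤expSum n = expSum-mono {0} {n} (ℕ.≤⇒≤′ ℕ.z≤n)

0<expSum : ∀ n → 0ℚ < expSum n
0<expSum n = ℚ.<-≤-trans 0<1 (1≤expSum n)

-- Multiplies the hypothesis by `m + 2` and by the partial sum of e; `expSum-ratio` then raises the
-- base from `m + 1` to `m + 2`. The factor `c` lets the weak and the strict bound share this step.
factorial-step : ∀ n m c →
  c * ι (suc m !) * expSum n ^ℚ m ≤ ι (suc m) ^ℚ suc (suc m) →
  c * ι (suc (suc m) !) * expSum n ^ℚ suc m ≤ ι (suc (suc m)) ^ℚ suc (suc (suc m))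
factorial-step n m c h = begin
  c * ι (suc (suc m) !) * (E * Eᵐ)             ≡⟨ cong (λ f → c * f * (E * Eᵐ))
                                                    (ι-* (suc (suc m)) (suc m !)) ⟩
  c * (M * ι (suc m !)) * (E * Eᵐ)             ≡⟨ solve 5 (λ c k f e p →
                                                    c :* (k :* f) :* (e :* p) :=
                                                    k :* (e :* (c :* f :* p)))
                                                    refl c M (ι (suc m !)) E Eᵐ ⟩
  M * (E * (c * ι (suc m !) * Eᵐ))             ≤⟨ *-monoˡ M (ι-nonNeg (suc (suc m)))
                                                    (*-monoˡ E (ℚ.<⇒≤ (0<expSum n)) h) ⟩
  M * (E * ι (suc m) ^ℚ suc (suc m))           ≤⟨ *-monoˡ M (ι-nonNeg (suc (suc m)))
                                                    (expSum-ratio n (suc m)) ⟩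
  M * M ^ℚ suc (suc m)                         ∎
  where
  open ℚ.≤-Reasoning
  E = expSum n
  Eᵐ = E ^ℚ m
  M = ι (suc (suc m))

factorial-bound : ∀ n m → 1ℚ * ι (suc m !) * expSum n ^ℚ m ≤ ι (suc m) ^ℚ suc (suc m)
factorial-bound n zero    = ℚ.≤-refl
factorial-bound n (suc m) = factorial-step n m 1ℚ (factorial-bound n m)

-- The constant 4/3 is what is left at m = 2, where 2e ≤ 6 against 2³ = 8.
factorial-strict-bound : ∀ n m →
  (+ 4 / 3) * ι (suc (suc m) !) * expSum n ^ℚ suc m ≤ ι (suc (suc m)) ^ℚ suc (suc (suc m))
factorial-strict-bound n zero = ℚ.≤-trans
  (ℚ.≤-reflexive (cong ((+ 4 / 3) * ι 2 *_) (ℚ.*-identityʳ (expSum n))))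
  (ℚ.≤-trans
    (*-monoˡ ((+ 4 / 3) * ι 2) (grid-nonNeg 2 8) (expSum≤3 n)) ℚ.≤-refl)
factorial-strict-bound n (suc m) =
  factorial-step n (suc m) (+ 4 / 3) (factorial-strict-bound n m)

-- Rational upper approximations to the radius

-- An upper approximation to seq (ρ m) n: one grid step is added to the
-- approximate root.
upperRadius : ℕ → ℕ → ℚ
upperRadius m n = ι m * inv (expSum n) * (approxRoot m n (ι m * expSum n) + unit n)

inv-expSum-nonNeg : ∀ n → 0ℚ ≤ inv (expSum n)
inv-expSum-nonNeg n = ℚ.<⇒≤ (inv-pos (0<expSum n))

upperRadius-nonNeg : ∀ m n → 0ℚ ≤ upperRadius m n
upperRadius-nonNeg m n = *-nonNeg (*-nonNeg (ι-nonNeg m) (inv-expSum-nonNeg n))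
  (ℚ.≤-trans (approxRoot-nonNeg m n (ι m * expSum n)) (≤-step (ℚ.<⇒≤ (unit-pos n))))

radius-slack : ∀ {M i} t u → 0ℚ ≤ M → 0ℚ ≤ u → i ≤ 1ℚ → M * i * (t + u) ≤ M * i * t + M * u
radius-slack {M} {i} t u 0≤M 0≤u i≤1 = begin
  M * i * (t + u)              ≡⟨ ℚ.*-distribˡ-+ (M * i) t u ⟩
  M * i * t + M * i * u        ≤⟨ ℚ.+-monoʳ-≤ (M * i * t) (*-monoʳ u 0≤u (*-monoˡ M 0≤M i≤1)) ⟩
  M * i * t + M * 1ℚ * u       ≡⟨ cong (λ x → M * i * t + x * u) (ℚ.*-identityʳ M) ⟩
  M * i * t + M * u            ∎
  where open ℚ.≤-Reasoning

inv-expSum≤1 : ∀ n → inv (expSum n) ≤ 1ℚ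
inv-expSum≤1 n = subst₂ _≤_ (ℚ.*-identityˡ (inv (expSum n))) (*-inv (0<expSum n))
  (*-monoʳ (inv (expSum n)) (inv-expSum-nonNeg n) (1≤expSum n))

seq-* : ∀ x y n → seq (x *ℝ y) n ≡ seq x n * seq y n
seq-* x y n = refl

seq-root : ∀ m .{{_ : NonZero m}} x n → seq (root m x) n ≡ approxRoot m n (seq x n)
seq-root m x n = refl

-- A bare refl would make the type checker evaluate the search in approxRoot.
seq-ρ : ∀ m .{{_ : NonZero m}} n →
  seq (ρ m) n ≡ ι m * inv (expSum n) * approxRoot m n (ι m * expSum n)
seq-ρ m n = trans
  (seq-* (fromℕ m *ℝ recip e 0<e) (root m (fromℕ m *ℝ e)) n)
  (cong₂ _*_ (seq-* (fromℕ m) (recip e 0<e) n)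
    (trans (seq-root m (fromℕ m *ℝ e) n) (cong (approxRoot m n) (seq-* (fromℕ m) e n))))

upperRadius-≤ : ∀ m .{{_ : NonZero m}} n → upperRadius m n ≤ seq (ρ m) n + ι m * unit n
upperRadius-≤ m n = subst (λ r → upperRadius m n ≤ r + ι m * unit n) (sym (seq-ρ m n))
  (radius-slack {ι m} {inv (expSum n)} (approxRoot m n (ι m * expSum n)) (unit n)
    (ι-nonNeg m) (ℚ.<⇒≤ (unit-pos n)) (inv-expSum≤1 n))

-- With `i` the inverse of `E`, the right side is at least (M/E)^(m+1) M E = M^(m+2)/E^m, which
-- dominates `F`.
radius-power : ∀ m {F E i M t} → 0ℚ ≤ E → 0ℚ ≤ i → 0ℚ ≤ M → E * i ≡ 1ℚ →
  F * E ^ℚ m ≤ M * M ^ℚ suc m → M * E ≤ t ^ℚ suc m → F ≤ (M * i * t) ^ℚ suc m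
radius-power m {F} {E} {i} {M} {t} 0≤E 0≤i 0≤M Ei≡1 h root≤ = begin
  F                                       ≡⟨ ℚ.*-identityʳ F ⟨
  F * 1ℚ                                  ≡⟨ cong (F *_) (1^ (suc m)) ⟨
  F * 1ℚ ^ℚ suc m                         ≡⟨ cong (λ x → F * x ^ℚ suc m) Ei≡1 ⟨
  F * (E * i) ^ℚ suc m                    ≡⟨ cong (F *_) (^-distrib-* E i (suc m)) ⟩
  F * (E * Eᵐ * iᵐ)                       ≡⟨ solve 4 (λ f e p q → f :* (e :* p :* q) :=
                                               (f :* p) :* (q :* e)) refl F E Eᵐ iᵐ ⟩
  F * Eᵐ * (iᵐ * E)                       ≤⟨ *-monoʳ (iᵐ * E) (*-nonNeg iᵐ-nonNeg 0≤E) h ⟩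
  M * Mᵐ * (iᵐ * E)                       ≡⟨ solve 4 (λ a b c d → a :* b :* (c :* d) :=
                                               b :* c :* (a :* d)) refl M Mᵐ iᵐ E ⟩
  Mᵐ * iᵐ * (M * E)                       ≤⟨ *-monoˡ (Mᵐ * iᵐ)
                                               (*-nonNeg (^-nonNeg (suc m) 0≤M) iᵐ-nonNeg) root≤ ⟩
  Mᵐ * iᵐ * t ^ℚ suc m                    ≡⟨ cong (_* t ^ℚ suc m) (^-distrib-* M i (suc m)) ⟨
  (M * i) ^ℚ suc m * t ^ℚ suc m           ≡⟨ ^-distrib-* (M * i) t (suc m) ⟨
  (M * i * t) ^ℚ suc m                    ∎
  where
  open ℚ.≤-Reasoning
  Eᵐ = E ^ℚ m
  iᵐ = i ^ℚ suc m
  Mᵐ = M ^ℚ suc m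
  iᵐ-nonNeg = ^-nonNeg (suc m) 0≤i

-- The added grid step puts the approximate root above the true one, so `radius-power` applies at
-- every index.
upperRadius-^ : ∀ m F n → F * expSum n ^ℚ m ≤ ι (suc m) ^ℚ suc (suc m) →
  F ≤ upperRadius (suc m) n ^ℚ suc m
upperRadius-^ m F n h = radius-power m (ℚ.<⇒≤ (0<expSum n)) (inv-expSum-nonNeg n)
  (ι-nonNeg (suc m)) (*-inv (0<expSum n)) h
  (ℚ.<⇒≤ (approxRoot-upper (suc m) n (ι (suc m) * expSum n)))

^-mono-< : ∀ {p q} m → 0ℚ ≤ p → p < q → p ^ℚ suc m < q ^ℚ suc m
^-mono-< {p} {q} m 0≤p p<q = ℚ.≤-<-trans
  (*-monoˡ p 0≤p (^-mono m 0≤p (ℚ.<⇒≤ p<q)))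
  (ℚ.*-monoˡ-<-pos (q ^ℚ m) {{positive (^-pos m (ℚ.≤-<-trans 0≤p p<q))}} p<q)

^-cancel-≤ : ∀ {p q} m .{{_ : NonZero m}} → 0ℚ ≤ q → p ^ℚ m ≤ q ^ℚ m → p ≤ q
^-cancel-≤ (suc m) 0≤q h = ℚ.≮⇒≥ λ q<p → ℚ.<-irrefl refl (ℚ.<-≤-trans (^-mono-< m 0≤q q<p) h)

-- Superadditivity of the power absorbs the error into the base: s ≤ c² + η² ≤ (c + η)². This
-- dictates the error term `(η * η) ^ℚ m`.
sqrt-bound : ∀ {r s c η} m .{{_ : NonZero m}} → r ≡ 0ℚ ⊎ r ^ℚ 2 ≤ s →
  0ℚ ≤ c → 0ℚ ≤ η → s ^ℚ m ≤ c ^ℚ m * c ^ℚ m + (η * η) ^ℚ m → r ≤ c + η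
sqrt-bound m (inj₁ refl) 0≤c 0≤η _ = ℚ.≤-trans 0≤c (≤-step 0≤η)
sqrt-bound {r} {s} {c} {η} m (inj₂ r²≤s) 0≤c 0≤η h =
  ^-cancel-≤ 2 (ℚ.≤-trans 0≤c (≤-step 0≤η)) (begin
    r ^ℚ 2                  ≤⟨ r²≤s ⟩
    s                       ≤⟨ ^-cancel-≤ m (ℚ.≤-trans 0≤cc (≤-step 0≤ηη)) (begin
      s ^ℚ m                      ≤⟨ h ⟩
      c ^ℚ m * c ^ℚ m + (η * η) ^ℚ m ≡⟨ cong (_+ (η * η) ^ℚ m) (^-distrib-* c c m) ⟨
      (c * c) ^ℚ m + (η * η) ^ℚ m ≤⟨ ^-superadditive m 0≤cc 0≤ηη ⟩
      (c * c + η * η) ^ℚ m        ∎) ⟩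
    c * c + η * η           ≤⟨ ≤-step (*-nonNeg (ℚ.+-mono-≤ 0≤c 0≤c) 0≤η) ⟩
    c * c + η * η + (c + c) * η ≡⟨ solve 2 (λ c η → c :* c :+ η :* η :+ (c :+ c) :* η :=
                                     (c :+ η) :* ((c :+ η) :* con 1ℚ)) refl c η ⟩
    (c + η) ^ℚ 2            ∎)
  where
  open ℚ.≤-Reasoning
  0≤cc = *-nonNeg 0≤c 0≤c
  0≤ηη = *-nonNeg 0≤η 0≤η

-- Choosing a small factor of a product

∏ : ℕ → (ℕ → ℚ) → ℚ
∏ zero    f = 1ℚ
∏ (suc m) f = f m * ∏ m f

^-≤-∏ : ∀ m {c} f → 0ℚ ≤ c → (∀ j → j ℕ.< m → c ≤ f j) → c ^ℚ m ≤ ∏ m f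
^-≤-∏ zero    f _   _  = ℚ.≤-refl
^-≤-∏ (suc m) {c} f 0≤c c≤ = *-mono 0≤c
  (ℚ.≤-trans (^-nonNeg m 0≤c) ih) (c≤ m ℕ.≤-refl) ih
  where ih = ^-≤-∏ m f 0≤c λ j j<m → c≤ j (ℕ.m<n⇒m<1+n j<m)

∀≤-suc : ∀ {m} {P : ℕ → Set} → (∀ j → j ℕ.≤ m → P j) → P (suc m) → ∀ j → j ℕ.≤ suc m → P j
∀≤-suc p q j j≤ with ℕ.m≤n⇒m<n∨m≡n j≤
... | inj₁ j<   = p j (ℕ.s≤s⁻¹ j<)
... | inj₂ refl = q

argmin : ∀ m (f : ℕ → ℚ) → ∃ λ k → k ℕ.≤ m × (∀ j → j ℕ.≤ m → f k ≤ f j)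
argmin zero    f = 0 , ℕ.z≤n , λ { zero _ → ℚ.≤-refl }
argmin (suc m) f with argmin m f
... | k , k≤m , min with ℚ.≤-total (f k) (f (suc m))
...   | inj₁ fk≤ = k , ℕ.m≤n⇒m≤1+n k≤m , ∀≤-suc {P = λ j → f k ≤ f j} min fk≤
...   | inj₂ ≤fk = suc m , ℕ.≤-refl , ∀≤-suc {P = λ j → f (suc m) ≤ f j}
                     (λ j j≤m → ℚ.≤-trans ≤fk (min j j≤m)) ℚ.≤-refl

eventually-∀< : ∀ m {P : ℕ → ℕ → Set} → (∀ k → Eventually (P k)) →
                Eventually λ n → ∀ k → k ℕ.< m → P k n
eventually-∀< zero    h = always λ _ _ ()
eventually-∀< (suc m) {P} h = eventually₂ {λ n → ∀ k → k ℕ.< m → P k n}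
  (λ n p q k k<1+m → go n p q k (ℕ.m≤n⇒m<n∨m≡n (ℕ.s≤s⁻¹ k<1+m)))
  (eventually-∀< m h) (h m)
  where
  go : ∀ n → (∀ k → k ℕ.< m → P k n) → P m n → ∀ k → k ℕ.< m ⊎ k ≡ m → P k n
  go n p q k (inj₁ k<m)  = p k k<m
  go n p q k (inj₂ refl) = q

infixr 8 _^ℝ_
_^ℝ_ : ℝ → ℕ → ℝ
x ^ℝ zero  = 1ℝ
x ^ℝ suc m = x *ℝ x ^ℝ m

seq-^ : ∀ x m n → seq (x ^ℝ m) n ≡ seq x n ^ℚ m
seq-^ x zero    n = refl
seq-^ x (suc m) n = cong (seq x n *_) (seq-^ x m n)

-- The least factor is chosen at one index `N`, where the factors are rationals and can be compared.
-- Half of `ε` bounds the product at `N`, the other half the later variation of the powers. As the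
-- choice is known only at `N`, all factors must be stable there. The resulting `k` depends on `ε`.
small-factor : ∀ m (S : ℕ → ℝ) a → (∀ k n → 0ℚ ≤ seq (S k) n) →
  (∀ ε → 0ℚ < ε → Eventually λ n → ∏ (suc m) (λ k → seq (S k) n) ≤ a + ε) →
  ∀ ε → 0ℚ < ε → Σ (Fin (suc m)) λ k →
    Eventually λ n → seq (S (toℕ k)) n ^ℚ suc m ≤ a + ε
small-factor m S a S≥0 lim ε 0<ε =
  let stable : ∀ k → Eventually λ N → ∀ n → N ℕ.≤ n →
                 seq (S k) n ^ℚ suc m ≤ seq (S k) N ^ℚ suc m + ε * ½
      stable k = let K , h = cauchy≤ (S k ^ℝ suc m) (ε * ½) (half 0<ε) in
        K , λ N K≤N n N≤n → subst₂ (λ p q → p ≤ q + ε * ½)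
          (seq-^ (S k) (suc m) n) (seq-^ (S k) (suc m) N)
          (h n N (ℕ.≤-trans K≤N N≤n) K≤N)
      N , h = eventually₂ (λ n p q → p , q) (lim (ε * ½) (half 0<ε)) (eventually-∀< (suc m) stable)
      product≤ , stays = h N ℕ.≤-refl
      k , k≤m , min = argmin m λ k → seq (S k) N
      k<1+m = ℕ.s≤s k≤m
      power≤ : seq (S k) N ^ℚ suc m ≤ a + ε * ½
      power≤ = ℚ.≤-trans
        (^-≤-∏ (suc m) (λ k → seq (S k) N) (S≥0 k N) λ j j<1+m → min j (ℕ.s≤s⁻¹ j<1+m)) product≤
  in Fin.fromℕ< k<1+m , N , λ n N≤n →
     subst (λ k → seq (S k) n ^ℚ suc m ≤ a + ε) (sym (Fin.toℕ-fromℕ< k<1+m))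
       (ℚ.≤-trans (stays k k<1+m n N≤n)
         (ℚ.≤-trans (ℚ.+-monoˡ-≤ (ε * ½) power≤)
           (ℚ.≤-reflexive (trans (ℚ.+-assoc a (ε * ½) (ε * ½)) (cong (_+_ a) (half+half ε))))))

-- Squared norms and the passage to the radius

normSq : ℂ → ℝ
normSq z = re z *ℝ re z +ℝ im z *ℝ im z

normSq-cong : ∀ w z → w ≈ℂ z → normSq w ≈ℝ normSq z
normSq-cong w z (h , k) = +ℝ-cong (re w *ℝ re w) (re z *ℝ re z) (im w *ℝ im w) (im z *ℝ im z)
  (*ℝ-cong (re w) (re z) (re w) (re z) h h) (*ℝ-cong (im w) (im z) (im w) (im z) k k)

-- The Brahmagupta-Fibonacci identity.
normSq-* : ∀ w z n → seq (normSq (w *ℂ z)) n ≡ seq (normSq w) n * seq (normSq z) n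
normSq-* w z n = solve 4 (λ a b c d →
  (a :* c :- b :* d) :* (a :* c :- b :* d) :+ (a :* d :+ b :* c) :* (a :* d :+ b :* c) :=
  (a :* a :+ b :* b) :* (c :* c :+ d :* d)) refl
  (seq (re w) n) (seq (im w) n) (seq (re z) n) (seq (im z) n)

0≤p² : ∀ p → 0ℚ ≤ p * p
0≤p² p with ℚ.≤-total 0ℚ p
... | inj₁ 0≤p = *-nonNeg 0≤p 0≤p
... | inj₂ p≤0 = subst (0ℚ ≤_) (solve 1 (λ p → :- p :* :- p := p :* p) refl p)
  (*-nonNeg (ℚ.neg-antimono-≤ p≤0) (ℚ.neg-antimono-≤ p≤0))

normSq-nonNeg : ∀ z n → 0ℚ ≤ seq (normSq z) n
normSq-nonNeg z n = ℚ.+-mono-≤ (0≤p² (seq (re z) n)) (0≤p² (seq (im z) n))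

normSq-ℕ→ℂ : ∀ a n → seq (normSq (ℕ→ℂ a)) n ≡ ι a * ι a
normSq-ℕ→ℂ a n = ℚ.+-identityʳ (ι a * ι a)

archimedean-* : ∀ m {ε} → 0ℚ < ε → Eventually λ n → ι m * unit n ≤ ε
archimedean-* m {ε} 0<ε =
  let N , unit≤ = archimedean (*-pos 0<ε (inv-pos (ι-suc-pos m)))
  in N , λ n N≤n → ℚ.≤-trans
    (*-mono (ι-nonNeg m) (ℚ.<⇒≤ (*-pos 0<ε (inv-pos (ι-suc-pos m)))) (ι-mono (ℕ.n≤1+n m))
      (ℚ.≤-trans (unit-antitone N≤n) unit≤))
    (ℚ.≤-reflexive (trans
      (solve 3 (λ a b c → a :* (b :* c) := b :* (a :* c)) refl (ι (suc m)) ε (inv (ι (suc m))))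
      (trans (cong (ε *_) (*-inv (ι-suc-pos m))) (ℚ.*-identityʳ ε))))

root-≤ : ∀ m .{{_ : NonZero m}} x r →
  (∀ n → upperRadius m n ≤ seq r n + ι m * unit n) →
  (∀ ε → 0ℚ < ε → Eventually λ n →
    seq x n ^ℚ m ≤ upperRadius m n ^ℚ m * upperRadius m n ^ℚ m + ε) →
  root 2 x ≤ℝ r
root-≤ m x r radius≤ h ε 0<ε = eventually₂
  (λ n small close → begin
    approxRoot 2 n (seq x n)             ≤⟨ sqrt-bound m (approxRoot-lower 2 n (seq x n))
                                              (upperRadius-nonNeg m n) (ℚ.<⇒≤ 0<η) small ⟩
    upperRadius m n + η                  ≤⟨ ℚ.+-monoˡ-≤ η (radius≤ n) ⟩
    (seq r n + ι m * unit n) + η         ≤⟨ ℚ.+-monoˡ-≤ η (ℚ.+-monoʳ-≤ (seq r n) close) ⟩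
    (seq r n + η) + η                    ≡⟨ ℚ.+-assoc (seq r n) η η ⟩
    seq r n + (η + η)                    ≡⟨ cong (_+_ (seq r n)) (half+half ε) ⟩
    seq r n + ε                          ∎)
  -- The tolerance has the shape that `sqrt-bound` absorbs at the cost of `η`; the other half of `ε`
  -- pays for the grid step in `upperRadius`.
  (h ((η * η) ^ℚ m) (^-pos m (*-pos 0<η 0<η)))
  (archimedean-* m 0<η)
  where
  open ℚ.≤-Reasoning
  η = ε * ½
  0<η = half 0<ε

root-≤-ρ : ∀ m .{{_ : NonZero m}} x →
  (∀ ε → 0ℚ < ε → Eventually λ n →
    seq x n ^ℚ m ≤ upperRadius m n ^ℚ m * upperRadius m n ^ℚ m + ε) →
  root 2 x ≤ℝ ρ m
root-≤-ρ m x = root-≤ m x (ρ m) (upperRadius-≤ m)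

-- Complex roots and the discs

open DividedDifference ℂ-commutativeRing using (NonZeroDivisor; Poly; Poly-zero; Poly-cong; Poly-horner)
open DescentRoots ℂ-commutativeRing using (falling; root⇒falling)

ℕ→ℂ-+ : ∀ a b → ℕ→ℂ (a ℕ.+ b) ≈ℂ ℕ→ℂ a +ℂ ℕ→ℂ b
ℕ→ℂ-+ a b = ≗⇒≈ℂ {ℕ→ℂ (a ℕ.+ b)} {ℕ→ℂ a +ℂ ℕ→ℂ b} (λ _ → ι-+ a b) (λ _ → refl)

ℕ→ℂ-* : ∀ a b → ℕ→ℂ (a ℕ.* b) ≈ℂ ℕ→ℂ a *ℂ ℕ→ℂ b
ℕ→ℂ-* a b = ≗⇒≈ℂ {ℕ→ℂ (a ℕ.* b)} {ℕ→ℂ a *ℂ ℕ→ℂ b}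
  (λ _ → trans (ι-* a b)
    (solve 2 (λ x y → x :* y := x :* y :- con 0ℚ :* con 0ℚ) refl (ι a) (ι b)))
  (λ _ → solve 2 (λ x y → con 0ℚ := x :* con 0ℚ :+ con 0ℚ :* y) refl (ι a) (ι b))

Null-cancel : ∀ {s} k → Null (λ n → ι (suc k) * s n) → Null s
Null-cancel {s} k h ε 0<ε = let N , f = h ε 0<ε in N , λ n ≤n → ℚ.≤-trans
  (subst (_≤ ∣ ι (suc k) * s n ∣) (ℚ.*-identityˡ ∣ s n ∣)
    (subst (1ℚ * ∣ s n ∣ ≤_)
      (sym (trans (ℚ.∣p*q∣≡∣p∣*∣q∣ (ι (suc k)) (s n))
        (cong (_* ∣ s n ∣) (ℚ.0≤p⇒∣p∣≡p (ι-nonNeg (suc k))))))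
      (*-monoʳ ∣ s n ∣ (ℚ.0≤∣p∣ (s n)) (1≤ι k))))
  (f n ≤n)

ℕ→ℂ-nonZeroDivisor : ∀ k → NonZeroDivisor (ℕ→ℂ (suc k))
ℕ→ℂ-nonZeroDivisor k y (h , h′) =
  Null-cancel k (Null-resp (λ n →
    solve 3 (λ c x y → (c :* x :- con 0ℚ :* y) :- con 0ℚ := c :* (x :- con 0ℚ)) refl
      (ι (suc k)) (seq (re y) n) (seq (im y) n)) h) ,
  Null-cancel k (Null-resp (λ n →
    solve 3 (λ c x y → (c :* y :+ con 0ℚ :* x) :- con 0ℚ := c :* (y :- con 0ℚ)) refl
      (ι (suc k)) (seq (re y) n) (seq (im y) n)) h′)

fallingℂ : ℂ → ℕ → ℂ
fallingℂ = falling ℕ→ℂ ℕ→ℂ-+ ℕ→ℂ-* ℕ→ℂ-nonZeroDivisor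

module ℂR = CommutativeRing ℂ-commutativeRing

-- The length of the list serves as the degree bound, whether or not its last coefficient vanishes.
eval-poly : ∀ p → Poly (length p) (eval p)
eval-poly []      = Poly-zero 0
eval-poly (c ∷ p) = Poly-cong (suc (length p)) {λ z → c ℂR.+ z ℂR.* eval p z} {eval (c ∷ p)}
  (λ z → ≗⇒≈ℂ {c ℂR.+ z ℂR.* eval p z} {eval (c ∷ p) z} (λ n → refl) (λ n → refl))
  (Poly-horner (length p) {eval p} c (eval-poly p))

root⇒fallingℂ : ∀ m (d : Polynomial) → IsDescentPolynomial (m ∷ []) d →
  ∀ z → eval d z ≈ℂ 0ℂ → fallingℂ z m ≈ℂ ℕ→ℂ (m !)
root⇒fallingℂ m d D = root⇒falling ℕ→ℂ ℕ→ℂ-+ ℕ→ℂ-* ℕ→ℂ-nonZeroDivisor m {f = eval d} (eval-poly d) λ i →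
  let N , card , d≈N = D (m ℕ.+ suc i)
        (ℕ.m<m+n m (ℕ.s≤s ℕ.z≤n))
  in N , cardinality-factorial {m} {suc i} card , d≈N

normSq-falling : ∀ z m n →
  seq (normSq (fallingℂ z m)) n ≡ ∏ m (λ k → seq (normSq (z -ℂ ℕ→ℂ k)) n)
normSq-falling z zero    n = refl
normSq-falling z (suc m) n = trans (normSq-* (z -ℂ ℕ→ℂ m) (fallingℂ z m) n)
  (cong (seq (normSq (z -ℂ ℕ→ℂ m)) n *_) (normSq-falling z m n))

small-distance : ∀ m d → IsDescentPolynomial (suc m ∷ []) d → ∀ z → eval d z ≈ℂ 0ℂ →
  ∀ ε → 0ℚ < ε → Σ (Fin (suc m)) λ k → Eventually λ n →
    seq (normSq (z -ℂ ℕ→ℂ (toℕ k))) n ^ℚ suc m ≤ ι (suc m !) * ι (suc m !) + ε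
small-distance m d D z dz≈0 = small-factor m (λ k → normSq (z -ℂ ℕ→ℂ k)) (ι F * ι F)
  (λ k n → normSq-nonNeg (z -ℂ ℕ→ℂ k) n)
  λ ε 0<ε → let N , close = normSq≈ ε 0<ε in N , λ n N≤n →
    subst₂ (λ p q → p ≤ q + ε) (normSq-falling z (suc m) n) (normSq-ℕ→ℂ F n)
      (∣-∣≤⇒ {seq (normSq (fallingℂ z (suc m))) n} {seq (normSq (ℕ→ℂ F)) n} (close n N≤n))
  where
  F = suc m !
  normSq≈ : normSq (fallingℂ z (suc m)) ≈ℝ normSq (ℕ→ℂ F)
  normSq≈ = normSq-cong (fallingℂ z (suc m)) (ℕ→ℂ F) (root⇒fallingℂ (suc m) d D z dz≈0)

-- (4/3)² = 1 + 7/9, and f² ≥ 1 turns the relative gap into an absolute one.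
square-gap : ∀ {f c} → 1ℚ ≤ f → (+ 4 / 3) * f ≤ c → f * f + (+ 7 / 9) ≤ c * c
square-gap {f} {c} 1≤f h = begin
  f * f + (+ 7 / 9)                 ≡⟨ cong (_+_ (f * f)) (ℚ.*-identityʳ (+ 7 / 9)) ⟨
  f * f + (+ 7 / 9) * (1ℚ * 1ℚ)     ≤⟨ ℚ.+-monoʳ-≤ (f * f) (*-monoˡ (+ 7 / 9) (grid-nonNeg 8 7)
                                         (*-mono (ℚ.<⇒≤ 0<1) 0≤f 1≤f 1≤f)) ⟩
  f * f + (+ 7 / 9) * (f * f)       ≡⟨ solve 1 (λ f → f :* f :+ con (+ 7 / 9) :* (f :* f) :=
                                         (con (+ 4 / 3) :* f) :* (con (+ 4 / 3) :* f)) refl f ⟩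
  (+ 4 / 3) * f * ((+ 4 / 3) * f)   ≤⟨ *-mono (*-nonNeg (grid-nonNeg 2 4) 0≤f)
                                         (ℚ.≤-trans (*-nonNeg (grid-nonNeg 2 4) 0≤f) h) h h ⟩
  c * c                             ∎
  where
  open ℚ.≤-Reasoning
  0≤f = ℚ.≤-trans (ℚ.<⇒≤ 0<1) 1≤f

1≤ι! : ∀ m → 1ℚ ≤ ι (m !)
1≤ι! m = ι-mono (ℕ.1≤n! m)

factorial²-bound : ∀ m n →
  ι (suc m !) * ι (suc m !) ≤ upperRadius (suc m) n ^ℚ suc m * upperRadius (suc m) n ^ℚ suc m
factorial²-bound m n = *-mono 0≤F (ℚ.≤-trans 0≤F F≤) F≤ F≤
  where
  0≤F = ι-nonNeg (suc m !)
  F≤ = subst (_≤ upperRadius (suc m) n ^ℚ suc m) (ℚ.*-identityˡ (ι (suc m !)))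
    (upperRadius-^ m (1ℚ * ι (suc m !)) n (factorial-bound n m))

factorial²-strict-bound : ∀ m n → let M = suc (suc m) in
  ι (M !) * ι (M !) + (+ 7 / 9) ≤ upperRadius M n ^ℚ M * upperRadius M n ^ℚ M
factorial²-strict-bound m n = square-gap (1≤ι! (suc (suc m)))
  (upperRadius-^ (suc m) ((+ 4 / 3) * ι (suc (suc m) !)) n (factorial-strict-bound n m))

NearDisc : ∀ m → ℂ → ℚ → Fin m → Set
NearDisc m z ε k = Eventually λ n →
  seq (normSq (z -ℂ ℕ→ℂ (toℕ k))) n ^ℚ m ≤ upperRadius m n ^ℚ m * upperRadius m n ^ℚ m + ε

norm-≤-ρ : ∀ m .{{_ : NonZero m}} w →
  (∀ ε → 0ℚ < ε → Eventually λ n →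
    seq (normSq w) n ^ℚ m ≤ upperRadius m n ^ℚ m * upperRadius m n ^ℚ m + ε) →
  ∣ w ∣ℂ ≤ℝ ρ m
norm-≤-ρ m w = root-≤-ρ m (normSq w)

disc-bound : ∀ m .{{_ : NonZero m}} z k → (∀ ε → 0ℚ < ε → NearDisc m z ε k) →
  ∣ z -ℂ ℕ→ℂ (toℕ k) ∣ℂ ≤ℝ ρ m
disc-bound m z k = norm-≤-ρ m (z -ℂ ℕ→ℂ (toℕ k))

near-disc : ∀ m d → IsDescentPolynomial (suc m ∷ []) d → ∀ z → eval d z ≈ℂ 0ℂ →
  ∀ ε → 0ℚ < ε → Σ (Fin (suc m)) (NearDisc (suc m) z ε)
near-disc m d D z dz≈0 ε 0<ε =
  let k , N , h = small-distance m d D z dz≈0 ε 0<ε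
  in k , N , λ n N≤n → ℚ.≤-trans (h n N≤n) (ℚ.+-monoˡ-≤ ε (factorial²-bound m n))

-- When there is only one disc, the root may lie on its boundary.
forced-disc : ∀ m .{{nz : NonZero (suc m)}} → (∀ (k : Fin (suc m)) → k ≡ Fin.zero) →
  ∀ d → IsDescentPolynomial (suc m ∷ []) d → ∀ z → eval d z ≈ℂ 0ℂ →
  Σ (Fin (suc m)) λ k → ∣ z -ℂ ℕ→ℂ (toℕ k) ∣ℂ ≤ℝ ρ (suc m) {{nz}}
forced-disc m {{nz}} unique d D z dz≈0 = Fin.zero , disc-bound (suc m) {{nz}} z Fin.zero λ ε 0<ε →
  -- `near-disc` chooses a disc anew for each `ε`; uniqueness makes the choices agree.
  let k , near = near-disc m d D z dz≈0 ε 0<ε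
  in subst (NearDisc (suc m) z ε) (unique k) near

-- A single choice at tolerance 7/9 fixes `k`. The strict bound swallows that tolerance, so the same
-- `k` serves every `ε`.
strict-disc : ∀ m .{{nz : NonZero (suc (suc m))}} d → IsDescentPolynomial (suc (suc m) ∷ []) d → ∀ z → eval d z ≈ℂ 0ℂ →
  Σ (Fin (suc (suc m))) λ k → ∣ z -ℂ ℕ→ℂ (toℕ k) ∣ℂ ≤ℝ ρ (suc (suc m)) {{nz}}
strict-disc m {{nz}} d D z dz≈0 =
  let k , N , h = small-distance (suc m) d D z dz≈0 (+ 7 / 9) (ℚ.positive⁻¹ (+ 7 / 9))
  in k , disc-bound (suc (suc m)) {{nz}} z k λ ε 0<ε → N , λ n N≤n →
    ℚ.≤-trans (h n N≤n) (ℚ.≤-trans (factorial²-strict-bound m n) (≤-step (ℚ.<⇒≤ 0<ε)))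

theorem4p8 : (m : ℕ) .{{_ : NonZero m}} (d : Polynomial) →
    IsDescentPolynomial (m ∷ []) d →
    (z : ℂ) → eval d z ≈ℂ 0ℂ →
    Σ (Fin m) λ k → ∣ z -ℂ ℕ→ℂ (toℕ k) ∣ℂ ≤ℝ ρ m
theorem4p8 zero {{nz}} = contradiction refl (ℕ.≢-nonZero⁻¹ 0)
theorem4p8 (suc zero) {{nz}} = forced-disc zero {{nz}} λ { Fin.zero → refl }
theorem4p8 (suc (suc m)) {{nz}} = strict-disc m {{nz}}
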